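{- A simplicial surface $X$ is a face-transitive surface with $\mathrm{vf}(X)=(3,1)$ if and only if $H:=\lambda_X(\mathrm{Aut}(X))$ is a $(3,1)$-group of the face graph $\mathcal F(X)$ and the cycle double cover $\mathcal C^{(3,1)}(H)$ contains exactly the vertex-defining cycles of $X$.
   Context: A simplicial complex $X$ on a finite non-empty set $P$ is a non-empty family of subsets of $P$ closed under taking subsets; $X_i$ is the set of its elements of cardinality $i+1$; elements of $X_0,X_1,X_2$ are vertices, edges, faces. A simplicial surface is a simplicial complex $X$ such that: all inclusion-maximal elements have cardinality $3$; every edge lies in exactly two faces; and for every vertex $v$ the faces containing $v$ can be arranged in a cyclic sequence $u(v)=(F_1,\dots,F_n)$ (each once), the umbrella of $v$, with $|F_i\cap F_{i+1}|=2$ (subscripts mod $n$). Simplicial surfaces are assumed strongly connected (any two faces joined by a sequence of faces with consecutive ones sharing an edge). $\mathrm{Aut}(X)$ is the automorphism group (permutations of $X_0$ mapping faces to faces). $X$ is face-transitive if $\mathrm{Aut}(X)$ is transitive on $X_2$; then $\mathrm{vf}(X)=(a,s)$ with $a$ the number of $\mathrm{Aut}(X)$-orbits on $X_0$ and $s$ the order of the stabiliser in $\mathrm{Aut}(X)$ of a face. All graphs are finite, simple, undirected, connected; their elements are called nodes and arcs. The face graph $\mathcal F(X)$ has node set $X_2$, two faces being joined by an arc iff they share an edge; it is cubic. $\lambda_X:\mathrm{Aut}(X)\to\mathrm{Aut}(\mathcal F(X))$ is the injective homomorphism sending an automorphism to the permutation it induces on $X_2$. Each umbrella $u(v)$ is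 a cycle in $\mathcal F(X)$, called a vertex-defining cycle of $X$. Cycles are considered up to rotation and reversal. A cycle double cover of a cubic graph is a set of cycles such that every arc lies in exactly two of them. It is vertex-faithful if all its cycles are chordless and any two distinct cycles share at most one arc. Let $\mathcal G=(V,E)$ be a cubic node-transitive graph (i.e. $\mathrm{Aut}(\mathcal G)$ is transitive on $V$). A subgroup $H\le\mathrm{Aut}(\mathcal G)$ is a $(3,1)$-group of $\mathcal G$ if: (1) $H$ acts transitively on $V$ with $|H|=|V|$; (2) $H$ has exactly three orbits $E_1,E_2,E_3$ on $E$; and (3) with respect to the arc-colouring $\kappa$ with $\kappa(e)=i$ for $e\in E_i$, the set of all bi-coloured cycles is a vertex-faithful cycle double cover of $\mathcal G$; this cover is denoted $\mathcal C^{(3,1)}(H)$. A cycle is bi-coloured if exactly two colours occur on its arcs and consecutive arcs (cyclically) have different colours. -}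

module Defs where

open import Data.Bool.Base using (Bool; true; false; T)
import Data.Bool.Properties as Bool
open import Data.Bool.Properties using (T?; T-irrelevant)
open import Data.Empty using (⊥-elim)
open import Data.Fin.Base using (Fin; zero; suc; toℕ; punchOut)
import Data.Fin.Properties as Fin
open import Data.Fin.Subset using (Subset; inside; outside; _∈_; _⊆_; _∩_; _∪_; ⁅_⁆; ∣_∣)
  renaming (⊥ to ∅)
open import Data.Fin.Subset.Properties using (∣⊥∣≡0; ∣⁅x⁆∣≡1; x∈⁅x⁆; x∈⁅y⁆⇒x≡y; x∈p∪q⁻; _⊆?_; ⊆-antisym; ∪-identityˡ; ∪-identityʳ)
open import Data.Nat.Base using (ℕ; zero; suc; _+_; _*_; _%_; _≤_; NonZero)
import Data.Nat.Properties as ℕ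
open import Data.Nat.DivMod using (_mod_; m<n⇒m%n≡m; m%n<n; %-distribˡ-+; [m+n]%n≡m%n)
open import Data.Product.Base using (Σ; ∃; ∃₂; ∃-syntax; Σ-syntax; _×_; _,_; proj₁; proj₂)
open import Data.Sum.Base as Sum using (_⊎_; inj₁; inj₂; [_,_]′)
open import Data.Sum.Function.Propositional using (_⊎-↔_)
open import Data.Vec.Base using ([]; _∷_; here; there)
open import Data.Vec.Properties using (≡-dec)
open import Function.Base using (_∘_; id)
open import Function.Bundles using (_↔_; _⇔_; mk⇔; mk↔ₛ′; Inverse; Equivalence)
open import Function.Construct.Composition using (_↔-∘_)
open import Function.Construct.Identity using (↔-id)
open import Function.Construct.Symmetry using (↔-sym)
open import Function.Definitions using (Injective)
open import Level using (0ℓ)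
open import Relation.Binary.Bundles using (Setoid)
open import Relation.Binary.Construct.Closure.ReflexiveTransitive using (Star; ε; _◅_)
import Relation.Binary.Construct.On as On
open import Relation.Binary.Core using (Rel)
open import Relation.Binary.Definitions using (DecidableEquality)
open import Relation.Binary.PropositionalEquality
  using (_≡_; _≢_; refl; sym; trans; cong; cong₂; subst; module ≡-Reasoning)
  renaming (setoid to ≡-setoid)
open import Relation.Nullary using (¬_; Dec; yes; no; contradiction)
open import Relation.Nullary.Decidable using (¬?; _×-dec_; map′)
open import Relation.Unary using (Pred)

open Inverse using (to; from; strictlyInverseˡ; strictlyInverseʳ)

-- The number of classes of a setoid.
HasCardinality : Setoid 0ℓ 0ℓ → ℕ → Set
HasCardinality S n = Inverse S (≡-setoid (Fin n))

Finite : Set → Set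
Finite A = ∃[ n ] A ↔ Fin n

Restrict : (S : Setoid 0ℓ 0ℓ) → Pred (Setoid.Carrier S) 0ℓ → Setoid 0ℓ 0ℓ
Restrict S P = On.setoid S (proj₁ {B = P})

finite-any? : {A : Set} {P : Pred A 0ℓ} → Finite A → (∀ x → Dec (P x)) → Dec (∃ P)
finite-any? {P = P} (n , i) P? = map′
  (λ (k , p) → from i k , p)
  (λ (x , p) → to i x , subst P (sym (strictlyInverseʳ i x)) p)
  (Fin.any? (P? ∘ from i))

Fin-surjective : ∀ {n} (g : Fin n → Fin n) → Injective _≡_ _≡_ g → ∀ y → ∃[ x ] g x ≡ y
Fin-surjective {suc n} g inj y with Fin.any? (λ x → g x Fin.≟ y)
... | yes p = p
... | no ∄x = contradiction (Fin.injective⇒≤ punched-injective) (ℕ.<⇒≱ (ℕ.n<1+n n))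
  where
  avoids : ∀ x → y ≢ g x
  avoids x y≡gx = ∄x (x , sym y≡gx)
  punched-injective : Injective _≡_ _≡_ (λ x → punchOut (avoids x))
  punched-injective {a} {b} eq = inj (Fin.punchOut-injective (avoids a) (avoids b) eq)

abstract
  finite-surjective : {A : Set} → Finite A → (f : A → A) → Injective _≡_ _≡_ f → ∀ y → ∃[ x ] f x ≡ y
  finite-surjective (n , i) f inj y
    with Fin-surjective (to i ∘ f ∘ from i) (from-injective ∘ inj ∘ to-injective) (to i y)
    where
    to-injective : Injective _≡_ _≡_ (to i)
    to-injective eq = trans (sym (strictlyInverseʳ i _)) (trans (cong (from i) eq) (strictlyInverseʳ i _))
    from-injective : Injective _≡_ _≡_ (from i)
    from-injective eq = trans (sym (strictlyInverseˡ i _)) (trans (cong (to i) eq) (strictlyInverseˡ i _))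
  ... | k , eq = from i k ,
    trans (sym (strictlyInverseʳ i _)) (trans (cong (from i) eq) (strictlyInverseʳ i y))

record PermutationGroup (A : Set) : Set₁ where
  field
    Member   : Pred (A ↔ A) 0ℓ
    resp     : ∀ {π ρ} → (∀ x → to π x ≡ to ρ x) → Member π → Member ρ
    identity : Member (↔-id A)
    compose  : ∀ {π ρ} → Member π → Member ρ → Member (π ↔-∘ ρ)
    inverse  : ∀ {π} → Member π → Member (↔-sym π)

  Element : Set
  Element = Σ (A ↔ A) Member

  infixl 20 _·_
  _·_ : Element → A → A
  g · x = to (proj₁ g) x

  elements : Setoid 0ℓ 0ℓ
  elements = record
    { Carrier = Element
    ; _≈_ = λ g h → ∀ x → g · x ≡ h · x
    ; isEquivalence = record
      { refl  = λ x → refl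
      ; sym   = λ p x → sym (p x)
      ; trans = λ p q x → trans (p x) (q x)
      }
    }

  Transitive : Set
  Transitive = ∀ x y → Σ[ g ∈ Element ] g · x ≡ y

  orbits : Setoid 0ℓ 0ℓ
  orbits = record
    { Carrier = A
    ; _≈_ = λ x y → Σ[ g ∈ Element ] g · x ≡ y
    ; isEquivalence = record
      { refl  = (_ , identity) , refl
      ; sym   = λ { ((π , m) , refl) → (_ , inverse m) , strictlyInverseʳ π _ }
      ; trans = λ { ((π , m) , refl) ((ρ , m′) , refl) → (_ , compose m′ m) , refl }
      }
    }

open PermutationGroup using (Member; Element; elements; Transitive; orbits)

_≤ᴳ_ : {A : Set} → PermutationGroup A → PermutationGroup A → Set
H ≤ᴳ K = ∀ π → Member H π → Member K π

next : ∀ {n} → Fin n → Fin n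
next {suc m} i = suc (toℕ i) mod suc m

next-injective : ∀ {n} → Injective _≡_ _≡_ (next {n})
next-injective {suc m} {i} {j} eq = Fin.toℕ-injective
  (trans (sym (back i)) (trans (cong (λ k → (toℕ k + m) % suc m) eq) (back j)))
  where
  open ≡-Reasoning
  back : ∀ k → (toℕ (next k) + m) % suc m ≡ toℕ k
  back k = begin
    (toℕ (next k) + m) % suc m
      ≡⟨ cong (λ t → (t + m) % suc m) (Fin.toℕ-fromℕ< (m%n<n (suc (toℕ k)) (suc m))) ⟩
    (suc (toℕ k) % suc m + m) % suc m
      ≡⟨ cong (λ t → (suc (toℕ k) % suc m + t) % suc m) (sym (m<n⇒m%n≡m (ℕ.n<1+n m))) ⟩
    (suc (toℕ k) % suc m + m % suc m) % suc m
      ≡⟨ sym (%-distribˡ-+ (suc (toℕ k)) m (suc m)) ⟩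
    (suc (toℕ k) + m) % suc m
      ≡⟨ cong (_% suc m) (sym (ℕ.+-suc (toℕ k) m)) ⟩
    (toℕ k + suc m) % suc m
      ≡⟨ [m+n]%n≡m%n (toℕ k) (suc m) ⟩
    toℕ k % suc m
      ≡⟨ m<n⇒m%n≡m (Fin.toℕ<n k) ⟩
    toℕ k ∎

-- The dihedral bijections of cyclic index sets: rotations commute with
-- `next`, reversals exchange `next` with its inverse.
IsRotation IsReversal : ∀ {m n} → Fin m ↔ Fin n → Set
IsRotation σ = ∀ i → to σ (next i) ≡ next (to σ i)
IsReversal σ = ∀ i → next (to σ (next i)) ≡ to σ i

record Graph : Set₁ where
  infix 4 _~_
  field
    Node      : Set
    finite    : Finite Node
    _~_       : Rel Node 0ℓ
    _~?_      : ∀ x y → Dec (x ~ y)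
    ~-sym     : ∀ {x y} → x ~ y → y ~ x
    ~-irrefl  : ∀ {x} → ¬ (x ~ x)
    connected : ∀ x y → Star _~_ x y

module _ (G : Graph) where
  open Graph G

  Cubic : Set
  Cubic = ∀ x → HasCardinality (Restrict (≡-setoid Node) (x ~_)) 3

  Aut : PermutationGroup Node
  Aut = record
    { Member   = λ π → ∀ x y → x ~ y ⇔ to π x ~ to π y
    ; resp     = λ {π} {ρ} eq p x y →
        subst (λ z → x ~ y ⇔ z ~ to ρ y) (eq x)
          (subst (λ z → x ~ y ⇔ to π x ~ z) (eq y) (p x y))
    ; identity = λ x y → mk⇔ id id
    ; compose  = λ {π} {ρ} p q x y → mk⇔
        (Equivalence.to (p (to ρ x) (to ρ y)) ∘ Equivalence.to (q x y))
        (Equivalence.from (q x y) ∘ Equivalence.from (p (to ρ x) (to ρ y)))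
    ; inverse  = λ {π} p x y →
        let eqv : from π x ~ from π y ⇔ x ~ y
            eqv = subst (λ z → from π x ~ from π y ⇔ z ~ y) (strictlyInverseˡ π x)
                    (subst (λ z → from π x ~ from π y ⇔ to π (from π x) ~ z) (strictlyInverseˡ π y)
                      (p (from π x) (from π y)))
        in mk⇔ (Equivalence.from eqv) (Equivalence.to eqv)
    }

  NodeTransitive : Set
  NodeTransitive = Transitive Aut

  -- An arc is stored with an orientation; equality of arcs forgets it.
  record Arc : Set where
    constructor arc
    field
      {source target} : Node
      adjacent        : source ~ target
  open Arc public

  -- {x , y} = {x′ , y′} as unordered pairs
  SamePair : (x y x′ y′ : Node) → Set
  SamePair x y x′ y′ = (x ≡ x′ × y ≡ y′) ⊎ (x ≡ y′ × y ≡ x′)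

  infix 4 _≈ᵃ_
  _≈ᵃ_ : Rel Arc 0ℓ
  e ≈ᵃ f = SamePair (source e) (target e) (source f) (target f)

  arcOrbits : PermutationGroup Node → Setoid 0ℓ 0ℓ
  arcOrbits H = record
    { Carrier = Arc
    ; _≈_ = λ e f → Σ[ h ∈ Element H ]
        SamePair (h · source e) (h · target e) (source f) (target f)
    ; isEquivalence = record
      { refl  = (_ , identity) , inj₁ (refl , refl)
      ; sym   = λ ((π , m) , q) → (_ , inverse m) , pair-sym π q
      ; trans = λ ((π , m) , q) ((ρ , m′) , r) → (_ , compose m′ m) , pair-trans ρ q r
      }
    }
    where open PermutationGroup H using (_·_; identity; compose; inverse)
          pair-sym : ∀ π {a b c d} → SamePair (to π a) (to π b) c d →
                     SamePair (from π c) (from π d) a b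
          pair-sym π (inj₁ (refl , refl)) = inj₁ (strictlyInverseʳ π _ , strictlyInverseʳ π _)
          pair-sym π (inj₂ (refl , refl)) = inj₂ (strictlyInverseʳ π _ , strictlyInverseʳ π _)

          pair-trans : ∀ (ρ : Node ↔ Node) {a b c d x y} → SamePair a b c d →
                       SamePair (to ρ c) (to ρ d) x y → SamePair (to ρ a) (to ρ b) x y
          pair-trans ρ (inj₁ (refl , refl)) r = r
          pair-trans ρ (inj₂ (refl , refl)) r =
            [ (λ (p , q) → inj₂ (q , p)) , (λ (p , q) → inj₁ (q , p)) ]′ r

  record Cycle : Set where
    field
      length    : ℕ
      3≤length  : 3 ≤ length
      node      : Fin length → Node
      injective : Injective _≡_ _≡_ node
      step      : ∀ i → node i ~ node (next i)

    arcAt : Fin length → Arc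
    arcAt i = arc (step i)

  open Cycle public

  record _≈ᶜ_ (c d : Cycle) : Set where
    field
      shift     : Fin (length c) ↔ Fin (length d)
      dihedral  : IsRotation shift ⊎ IsReversal shift
      same-node : ∀ i → node c i ≡ node d (to shift i)

  cycles : Setoid 0ℓ 0ℓ
  cycles = record
    { Carrier = Cycle
    ; _≈_ = _≈ᶜ_
    ; isEquivalence = record { refl = ≈-refl ; sym = ≈-sym ; trans = ≈-trans }
    }
    where
    open _≈ᶜ_
    ≈-refl : ∀ {c} → c ≈ᶜ c
    ≈-refl = record { shift = ↔-id _ ; dihedral = inj₁ (λ i → refl) ; same-node = λ i → refl }

    ≈-sym : ∀ {c d} → c ≈ᶜ d → d ≈ᶜ c
    ≈-sym {c} {d} p = record
      { shift     = ↔-sym σ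
      ; dihedral  = Sum.map rotation reversal (dihedral p)
      ; same-node = λ j → sym (trans (same-node p (from σ j)) (cong (node d) (strictlyInverseˡ σ j)))
      }
      where
      σ = shift p
      rotation : IsRotation σ → IsRotation (↔-sym σ)
      rotation r j = trans
        (cong (from σ) (sym (trans (r (from σ j)) (cong next (strictlyInverseˡ σ j)))))
        (strictlyInverseʳ σ _)
      reversal : IsReversal σ → IsReversal (↔-sym σ)
      reversal r j = trans (sym (strictlyInverseʳ σ _)) (cong (from σ)
        (next-injective (trans (r (from σ (next j))) (strictlyInverseˡ σ (next j)))))

    ≈-trans : ∀ {c d e} → c ≈ᶜ d → d ≈ᶜ e → c ≈ᶜ e
    ≈-trans {c} {d} {e} p q = record
      { shift     = τ ↔-∘ σ
      ; dihedral  = combine (dihedral p) (dihedral q)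
      ; same-node = λ i → trans (same-node p i) (same-node q (to σ i))
      }
      where
      σ = shift p
      τ = shift q
      combine : IsRotation σ ⊎ IsReversal σ → IsRotation τ ⊎ IsReversal τ →
                IsRotation (τ ↔-∘ σ) ⊎ IsReversal (τ ↔-∘ σ)
      combine (inj₁ r) (inj₁ s) = inj₁ λ i → trans (cong (to τ) (r i)) (s (to σ i))
      combine (inj₁ r) (inj₂ s) = inj₂ λ i → trans (cong (next ∘ to τ) (r i)) (s (to σ i))
      combine (inj₂ r) (inj₁ s) = inj₂ λ i → trans (sym (s (to σ (next i)))) (cong (to τ) (r i))
      combine (inj₂ r) (inj₂ s) = inj₁ λ i →
        trans (sym (s (to σ (next i)))) (cong (next ∘ to τ) (r i))

  _∈ᵃ_ : Arc → Cycle → Set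
  e ∈ᵃ c = ∃[ i ] e ≈ᵃ arcAt c i

  Chordless : Cycle → Set
  Chordless c = ∀ i j → node c i ~ node c j → j ≡ next i ⊎ i ≡ next j

  IsCycleDoubleCover : Pred Cycle 0ℓ → Set
  IsCycleDoubleCover C = ∀ e → HasCardinality (Restrict cycles (λ c → C c × e ∈ᵃ c)) 2

  record IsVertexFaithful (C : Pred Cycle 0ℓ) : Set where
    field
      chordless    : ∀ c → C c → Chordless c
      ≤1-commonArc : ∀ c d → C c → C d → ¬ (c ≈ᶜ d) →
                     ∀ e f → e ∈ᵃ c → e ∈ᵃ d → f ∈ᵃ c → f ∈ᵃ d → e ≈ᵃ f

  record BiColoured {k : ℕ} (κ : Arc → Fin k) (c : Cycle) : Set where
    field
      colour₁ colour₂ : Fin k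
      distinct        : colour₁ ≢ colour₂
      occurs₁         : ∃[ i ] κ (arcAt c i) ≡ colour₁
      occurs₂         : ∃[ i ] κ (arcAt c i) ≡ colour₂
      only            : ∀ i → κ (arcAt c i) ≡ colour₁ ⊎ κ (arcAt c i) ≡ colour₂
      alternating     : ∀ i → κ (arcAt c i) ≢ κ (arcAt c (next i))

  record Is⟨3,1⟩Group (H : PermutationGroup Node) : Set where
    field
      cubic          : Cubic
      nodeTransitive : NodeTransitive
      subgroup       : H ≤ᴳ Aut
      transitive     : Transitive H
      -- ∣H∣ = ∣V∣
      order          : Inverse (elements H) (≡-setoid Node)
      threeArcOrbits : HasCardinality (arcOrbits H) 3

    -- The numbering of the three orbits is immaterial for bi-colouredness.
    κ : Arc → Fin 3
    κ = to threeArcOrbits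

    𝒞⟨3,1⟩ : Pred Cycle 0ℓ
    𝒞⟨3,1⟩ = BiColoured κ

    field
      doubleCover    : IsCycleDoubleCover 𝒞⟨3,1⟩
      vertexFaithful : IsVertexFaithful 𝒞⟨3,1⟩

subset-finite : ∀ {p} (P : Pred (Subset p) 0ℓ) → (∀ s → Dec (P s)) →
                (∀ {s} (x y : P s) → x ≡ y) → Finite (Σ (Subset p) P)
subset-finite {zero} P P? irr with P? []
... | yes x = 1 , mk↔ₛ′ (λ _ → zero) (λ _ → [] , x) (λ { zero → refl })
                    (λ { ([] , y) → cong ([] ,_) (irr x y) })
... | no ¬x = 0 , mk↔ₛ′ (λ { ([] , x) → ⊥-elim (¬x x) }) (λ ()) (λ ())
                    (λ { ([] , x) → ⊥-elim (¬x x) })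
subset-finite {suc p} P P? irr
  with subset-finite (P ∘ (inside ∷_)) (P? ∘ (inside ∷_)) irr
     | subset-finite (P ∘ (outside ∷_)) (P? ∘ (outside ∷_)) irr
... | m , i | n , j = m + n , ↔-sym Fin.+↔⊎ ↔-∘ ((i ⊎-↔ j) ↔-∘ split)
  where
  split : Σ (Subset (suc p)) P ↔
          (Σ (Subset p) (P ∘ (inside ∷_)) ⊎ Σ (Subset p) (P ∘ (outside ∷_)))
  split = mk↔ₛ′
    (λ { (true ∷ s , x) → inj₁ (s , x) ; (false ∷ s , x) → inj₂ (s , x) })
    (λ { (inj₁ (s , x)) → inside ∷ s , x ; (inj₂ (s , x)) → outside ∷ s , x })
    (λ { (inj₁ _) → refl ; (inj₂ _) → refl })
    (λ { (true ∷ s , x) → refl ; (false ∷ s , x) → refl })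

∣s∣≡0⇒s≡∅ : ∀ {p} (s : Subset p) → ∣ s ∣ ≡ 0 → s ≡ ∅
∣s∣≡0⇒s≡∅ []          eq = refl
∣s∣≡0⇒s≡∅ (false ∷ s) eq = cong (outside ∷_) (∣s∣≡0⇒s≡∅ s eq)

∣s∣≡1⇒singleton : ∀ {p} (s : Subset p) → ∣ s ∣ ≡ 1 → ∃[ x ] s ≡ ⁅ x ⁆
∣s∣≡1⇒singleton (true ∷ s)  eq = zero , cong (inside ∷_) (∣s∣≡0⇒s≡∅ s (ℕ.suc-injective eq))
∣s∣≡1⇒singleton (false ∷ s) eq with ∣s∣≡1⇒singleton s eq
... | x , s≡ = suc x , cong (outside ∷_) s≡

∣s∣≡2⇒pair : ∀ {p} (s : Subset p) → ∣ s ∣ ≡ 2 → ∃₂ λ x y → x ≢ y × x ∈ s × y ∈ s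
∣s∣≡2⇒pair (true ∷ s) eq with ∣s∣≡1⇒singleton s (ℕ.suc-injective eq)
... | y , refl = zero , suc y , (λ ()) , here , there (x∈⁅x⁆ y)
∣s∣≡2⇒pair (false ∷ s) eq with ∣s∣≡2⇒pair s eq
... | x , y , x≢y , x∈s , y∈s = suc x , suc y , x≢y ∘ Fin.suc-injective , there x∈s , there y∈s

∣pair∣≡2 : ∀ {p} (x y : Fin p) → x ≢ y → ∣ ⁅ x ⁆ ∪ ⁅ y ⁆ ∣ ≡ 2
∣pair∣≡2 zero    zero    x≢y = contradiction refl x≢y
∣pair∣≡2 zero    (suc y) x≢y = cong suc (trans (cong ∣_∣ (∪-identityˡ ⁅ y ⁆)) (∣⁅x⁆∣≡1 y))
∣pair∣≡2 (suc x) zero    x≢y = cong suc (trans (cong ∣_∣ (∪-identityʳ ⁅ x ⁆)) (∣⁅x⁆∣≡1 x))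
∣pair∣≡2 (suc x) (suc y) x≢y = ∣pair∣≡2 x y (x≢y ∘ cong suc)

record SimplicialComplex : Set where
  field
    groundSize      : ℕ
    ground-nonempty : NonZero groundSize
    member          : Subset groundSize → Bool
    nonempty        : ∃[ s ] T (member s)
    downward-closed : ∀ {s t} → T (member s) → t ⊆ s → T (member t)

module Complex (X : SimplicialComplex) where
  open SimplicialComplex X public

  -- X_i
  record Simplex (i : ℕ) : Set where
    constructor simplex
    field
      support   : Subset groundSize
      isMember  : T (member support)
      dimension : ∣ support ∣ ≡ suc i
  open Simplex public

  Vertex Edge Face : Set
  Vertex = Simplex 0
  Edge   = Simplex 1
  Face   = Simplex 2

  infix 4 _⊑_
  record _⊑_ {i j} (s : Simplex i) (t : Simplex j) : Set where
    constructor sub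
    field incl : support s ⊆ support t
  open _⊑_ public

  ShareEdge : Rel Face 0ℓ
  ShareEdge F G = Σ[ e ∈ Edge ] e ⊑ F × e ⊑ G

  -- The condition on G says G = { φ v ∣ v vertex of F }.
  IsImage : Vertex ↔ Vertex → Rel Face 0ℓ
  IsImage φ F G = ∀ v → v ⊑ F ⇔ to φ v ⊑ G

  MapsFacesToFaces : Vertex ↔ Vertex → Set
  MapsFacesToFaces φ = ∀ F → Σ[ G ∈ Face ] IsImage φ F G

  -- `F` lists every face containing `v` exactly once, in cyclic order.
  record IsUmbrella (v : Vertex) {n : ℕ} (F : Fin n → Face) : Set where
    field
      once        : Injective _≡_ _≡_ F
      enumerates  : ∀ G → v ⊑ G ⇔ (∃[ i ] F i ≡ G)
      consecutive : ∀ i → ∣ support (F i) ∩ support (F (next i)) ∣ ≡ 2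

  simplex-≡ : ∀ {i} {s t : Simplex i} → support s ≡ support t → s ≡ t
  simplex-≡ {s = simplex _ m d} {simplex _ m′ d′} refl =
    cong₂ (simplex _) (T-irrelevant m m′) (ℕ.≡-irrelevant d d′)

  simplices-finite : ∀ i → Finite (Simplex i)
  simplices-finite i = proj₁ fin , proj₂ fin ↔-∘ mk↔ₛ′
      (λ (simplex s m d) → s , m , d) (λ (s , m , d) → simplex s m d) (λ _ → refl) (λ _ → refl)
    where
    fin : Finite (Σ (Subset groundSize) (λ s → T (member s) × ∣ s ∣ ≡ suc i))
    fin = subset-finite _ (λ s → T? (member s) ×-dec (∣ s ∣ ℕ.≟ suc i))
      (λ (m , d) (m′ , d′) → cong₂ _,_ (T-irrelevant m m′) (ℕ.≡-irrelevant d d′))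

  _≟ˢ_ : ∀ {i} → DecidableEquality (Simplex i)
  s ≟ˢ t = map′ simplex-≡ (cong support) (≡-dec Bool._≟_ (support s) (support t))

  _⊑?_ : ∀ {i j} (s : Simplex i) (t : Simplex j) → Dec (s ⊑ t)
  s ⊑? t with support s ⊆? support t
  ... | yes s⊆t = yes (sub s⊆t)
  ... | no s⊈t  = no (λ s⊑t → s⊈t (incl s⊑t))

  ⁅⁆⊆ : ∀ {x} {s : Subset groundSize} → x ∈ s → ⁅ x ⁆ ⊆ s
  ⁅⁆⊆ {x} {s} x∈s y∈ = subst (_∈ s) (sym (x∈⁅y⁆⇒x≡y x y∈)) x∈s

  vertexAt : ∀ {i} (s : Simplex i) {x} → x ∈ support s → Vertex
  vertexAt s {x} x∈s = simplex ⁅ x ⁆ (downward-closed (isMember s) (⁅⁆⊆ x∈s)) (∣⁅x⁆∣≡1 x)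

  ⊑-from-vertices : (F G : Face) → (∀ v → v ⊑ F → v ⊑ G) → F ⊑ G
  ⊑-from-vertices F G h = sub λ {x} x∈F →
    incl (h (vertexAt F x∈F) (sub (⁅⁆⊆ x∈F))) (x∈⁅x⁆ x)

  face-≡ : ∀ {F G} → (∀ v → v ⊑ F ⇔ v ⊑ G) → F ≡ G
  face-≡ {F} {G} h = simplex-≡ (⊆-antisym
    (incl (⊑-from-vertices F G (λ v → Equivalence.to (h v))))
    (incl (⊑-from-vertices G F (λ v → Equivalence.from (h v)))))

  image-unique : ∀ φ {F G G′} → IsImage φ F G → IsImage φ F G′ → G ≡ G′
  image-unique φ {G = G} {G′} p q = face-≡ λ w →
    mk⇔ (transport {G} {G′} p q w) (transport {G′} {G} q p w)
    where
    transport : ∀ {K L F} → IsImage φ F K → IsImage φ F L → ∀ w → w ⊑ K → w ⊑ L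
    transport {K} {L} p q w w⊑K = subst (_⊑ L) (strictlyInverseˡ φ w)
      (Equivalence.to (q (from φ w))
        (Equivalence.from (p (from φ w)) (subst (_⊑ K) (sym (strictlyInverseˡ φ w)) w⊑K)))

  IsImage-resp : ∀ {φ ψ F G} → (∀ v → to φ v ≡ to ψ v) → IsImage φ F G → IsImage ψ F G
  IsImage-resp {F = F} {G} eq p v = subst (λ w → v ⊑ F ⇔ w ⊑ G) (eq v) (p v)

  IsImage-∘ : ∀ {φ ψ F G K} → IsImage ψ F G → IsImage φ G K → IsImage (φ ↔-∘ ψ) F K
  IsImage-∘ {ψ = ψ} q p v = mk⇔
    (Equivalence.to (p (to ψ v)) ∘ Equivalence.to (q v))
    (Equivalence.from (q v) ∘ Equivalence.from (p (to ψ v)))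

  IsImage-inverse : ∀ {φ F G} → IsImage φ F G → IsImage (↔-sym φ) G F
  IsImage-inverse {φ} {F} {G} p w = mk⇔ (Equivalence.from eqv) (Equivalence.to eqv)
    where
    eqv : from φ w ⊑ F ⇔ w ⊑ G
    eqv = subst (λ u → from φ w ⊑ F ⇔ u ⊑ G) (strictlyInverseˡ φ w) (p (from φ w))

  image-injective : ∀ φ (m : MapsFacesToFaces φ) → Injective _≡_ _≡_ (proj₁ ∘ m)
  image-injective φ m {F} {G} eq = face-≡ λ v → mk⇔
    (λ v⊑F → Equivalence.from (proj₂ (m G) v) (subst (to φ v ⊑_) eq (Equivalence.to (proj₂ (m F) v) v⊑F)))
    (λ v⊑G → Equivalence.from (proj₂ (m F) v) (subst (to φ v ⊑_) (sym eq) (Equivalence.to (proj₂ (m G) v) v⊑G)))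

  -- Injectivity on the finite set of faces gives surjectivity, so the
  -- inverse of an automorphism again maps faces to faces.
  maps-inverse : ∀ {φ} → MapsFacesToFaces φ → MapsFacesToFaces (↔-sym φ)
  maps-inverse {φ} m G = F , subst (λ K → IsImage (↔-sym φ) K F) eq (IsImage-inverse {φ} {F} (proj₂ (m F)))
    where
    preimage : Σ[ F ∈ Face ] proj₁ (m F) ≡ G
    preimage = finite-surjective (simplices-finite 2) (proj₁ ∘ m) (image-injective φ m) G
    F : Face
    F = proj₁ preimage
    eq : proj₁ (m F) ≡ G
    eq = proj₂ preimage

  vertex-point : (v : Vertex) → ∃[ x ] support v ≡ ⁅ x ⁆
  vertex-point v = ∣s∣≡1⇒singleton (support v) (dimension v)

  AutX : PermutationGroup Vertex
  AutX = record
    { Member   = MapsFacesToFaces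
    ; resp     = λ {φ} {ψ} eq m F → proj₁ (m F) , IsImage-resp {φ} {ψ} {F} {proj₁ (m F)} eq (proj₂ (m F))
    ; identity = λ F → F , λ v → mk⇔ id id
    ; compose  = λ {φ} {ψ} m m′ F → let G = proj₁ (m′ F) in
        proj₁ (m G) , IsImage-∘ {φ} {ψ} {F} {G} {proj₁ (m G)} (proj₂ (m′ F)) (proj₂ (m G))
    ; inverse  = λ {φ} m → maps-inverse {φ} m
    }

  onFaces : Element AutX → Face ↔ Face
  onFaces (φ , m) = mk↔ₛ′ (λ F → proj₁ (m F)) (λ F → proj₁ (m⁻¹ F))
    (λ G → let F = proj₁ (m⁻¹ G) in
      image-unique φ {F} (proj₂ (m F)) (IsImage-inverse {↔-sym φ} {G} {F} (proj₂ (m⁻¹ G))))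
    (λ F → let G = proj₁ (m F) in
      image-unique (↔-sym φ) {G} (proj₂ (m⁻¹ G)) (IsImage-inverse {φ} {F} {G} (proj₂ (m F))))
    where
    m⁻¹ : MapsFacesToFaces (↔-sym φ)
    m⁻¹ = maps-inverse {φ} m

  FaceTransitive : Set
  FaceTransitive = ∀ F G → Σ[ φ ∈ Element AutX ] to (onFaces φ) F ≡ G

  faceStabiliser : Face → Setoid 0ℓ 0ℓ
  faceStabiliser F = Restrict (elements AutX) (λ φ → to (onFaces φ) F ≡ F)

  -- vf(X) = (a , s); meaningful for face-transitive X, where all face
  -- stabilisers are conjugate.
  record HasVf (a s : ℕ) : Set where
    field
      vertexOrbits    : HasCardinality (orbits AutX) a
      stabiliserOrder : ∀ F → HasCardinality (faceStabiliser F) s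

  -- φ maps an edge {x , y} of F to the edge {φ x , φ y} of φ F.
  ShareEdge-image : ∀ φ {F G F′ G′} → IsImage φ F F′ → IsImage φ G G′ →
                    ShareEdge F G → ShareEdge F′ G′
  ShareEdge-image φ {F} {G} {F′} {G′} p q (e , e⊑F , e⊑G)
    with ∣s∣≡2⇒pair (support e) (dimension e)
  ... | x , y , x≢y , x∈e , y∈e
    with vertex-point (to φ (vertexAt e x∈e)) | vertex-point (to φ (vertexAt e y∈e))
  ... | x′ , φx | y′ , φy = e′ , sub (e′⊆ F′ (x′∈ p e⊑F) (y′∈ p e⊑F)) , sub (e′⊆ G′ (x′∈ q e⊑G) (y′∈ q e⊑G))
    where
    u w : Vertex
    u = vertexAt e x∈e
    w = vertexAt e y∈e

    x′∈ : ∀ {K K′} → IsImage φ K K′ → e ⊑ K → x′ ∈ support K′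
    x′∈ r e⊑K = incl (Equivalence.to (r u) (sub (⁅⁆⊆ (incl e⊑K x∈e)))) (subst (x′ ∈_) (sym φx) (x∈⁅x⁆ x′))

    y′∈ : ∀ {K K′} → IsImage φ K K′ → e ⊑ K → y′ ∈ support K′
    y′∈ r e⊑K = incl (Equivalence.to (r w) (sub (⁅⁆⊆ (incl e⊑K y∈e)))) (subst (y′ ∈_) (sym φy) (x∈⁅x⁆ y′))

    u≡w : x′ ≡ y′ → u ≡ w
    u≡w x′≡y′ = trans (sym (strictlyInverseʳ φ u)) (trans
      (cong (from φ) (simplex-≡ (trans φx (trans (cong ⁅_⁆ x′≡y′) (sym φy)))))
      (strictlyInverseʳ φ w))

    x′≢y′ : x′ ≢ y′
    x′≢y′ x′≡y′ = x≢y (x∈⁅y⁆⇒x≡y y (subst (x ∈_) (cong support (u≡w x′≡y′)) (x∈⁅x⁆ x)))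

    e′⊆ : ∀ K → x′ ∈ support K → y′ ∈ support K → ⁅ x′ ⁆ ∪ ⁅ y′ ⁆ ⊆ support K
    e′⊆ K x′∈K y′∈K z∈ = [ ⁅⁆⊆ x′∈K , ⁅⁆⊆ y′∈K ]′ (x∈p∪q⁻ ⁅ x′ ⁆ ⁅ y′ ⁆ z∈)

    e′ : Edge
    e′ = simplex (⁅ x′ ⁆ ∪ ⁅ y′ ⁆)
      (downward-closed (isMember F′) (e′⊆ F′ (x′∈ p e⊑F) (y′∈ p e⊑F)))
      (∣pair∣≡2 x′ y′ x′≢y′)

  infix 4 _adjacentTo_
  _adjacentTo_ : Rel Face 0ℓ
  F adjacentTo G = F ≢ G × ShareEdge F G

  faceGraph : (∀ F G → Star ShareEdge F G) → Graph
  faceGraph strongly-connected = record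
    { Node      = Face
    ; finite    = simplices-finite 2
    ; _~_       = _adjacentTo_
    ; _~?_      = λ F G → ¬? (F ≟ˢ G) ×-dec
        finite-any? (simplices-finite 1)
          (λ e → (e ⊑? F) ×-dec (e ⊑? G))
    ; ~-sym     = λ (F≢G , e , e⊑F , e⊑G) → F≢G ∘ sym , e , e⊑G , e⊑F
    ; ~-irrefl  = λ (F≢F , _) → F≢F refl
    ; connected = λ F G → dropLoops (strongly-connected F G)
    }
    where
    dropLoops : ∀ {F G} → Star ShareEdge F G → Star _adjacentTo_ F G
    dropLoops ε = ε
    dropLoops (_◅_ {F} {G} s path) with F ≟ˢ G
    ... | yes refl = dropLoops path
    ... | no F≢G   = (F≢G , s) ◅ dropLoops path

  onFaces-adjacent : ∀ φ F G → F adjacentTo G ⇔ to (onFaces φ) F adjacentTo to (onFaces φ) G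
  onFaces-adjacent (φ , m) F G = mk⇔
    (λ (F≢G , s) → F≢G ∘ image-injective φ m ,
      ShareEdge-image φ {F} {G} (proj₂ (m F)) (proj₂ (m G)) s)
    (λ (φF≢φG , s) → (λ { refl → φF≢φG refl }) ,
      ShareEdge-image (↔-sym φ) {proj₁ (m F)} {proj₁ (m G)}
        (IsImage-inverse {φ} {F} (proj₂ (m F))) (IsImage-inverse {φ} {G} (proj₂ (m G))) s)

record SimplicialSurface : Set where
  field
    complex : SimplicialComplex
  open Complex complex public
  field
    pure : ∀ s → T (member s) → (∀ t → T (member t) → s ⊆ t → s ≡ t) → ∣ s ∣ ≡ 3
    edge-in-two-faces  : ∀ (e : Edge) → HasCardinality (Restrict (≡-setoid Face) (e ⊑_)) 2
    umbrella           : ∀ (v : Vertex) → ∃₂ λ n (F : Fin n → Face) → IsUmbrella v F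
    strongly-connected : ∀ F G → Star ShareEdge F G

  ℱ : Graph
  ℱ = faceGraph strongly-connected

  λX : Element AutX → Element (Aut ℱ)
  λX φ = onFaces φ , onFaces-adjacent φ

  λX[AutX] : PermutationGroup Face
  λX[AutX] = record
    { Member   = λ π → Σ[ φ ∈ Element AutX ] ∀ F → to (proj₁ (λX φ)) F ≡ to π F
    ; resp     = λ eq (φ , p) → φ , λ F → trans (p F) (eq F)
    ; identity = (↔-id Vertex , identity) , λ F → refl
    ; compose  = λ {π} (φ , p) (ψ , q) →
        (proj₁ φ ↔-∘ proj₁ ψ , compose {proj₁ φ} {proj₁ ψ} (proj₂ φ) (proj₂ ψ)) ,
        λ F → trans (p (to (onFaces ψ) F)) (cong (to π) (q F))
    ; inverse  = λ {π} (φ , p) → (↔-sym (proj₁ φ) , inverse {proj₁ φ} (proj₂ φ)) ,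
        λ F → trans
          (cong (from (onFaces φ)) (trans (sym (strictlyInverseˡ π F)) (sym (p (from π F)))))
          (strictlyInverseʳ (onFaces φ) (from π F))
    }
    where open PermutationGroup AutX using (identity; compose; inverse)

  -- Umbrellas are unique up to rotation and reversal, so no choice of u(v)
  -- needs to be recorded.
  VertexDefining : Pred (Cycle ℱ) 0ℓ
  VertexDefining c = ∃[ v ] IsUmbrella v (node c)

-- The neighbour of a face F across an edge misses exactly one vertex of F, the
-- one opposite to that edge, so arcs at F correspond to vertices of F.
-- For vf(X) = (3,1) every face has one vertex of each orbit; colouring an arc by
-- the orbit of the vertex it misses, a vertex keeps belonging to the faces of a
-- cycle exactly as long as its colour does not occur, which makes the bi-coloured
-- cycles the umbrellas.  Conversely, if the umbrellas are bi-coloured then the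
-- three arcs at a face have different colours, and the colour of the arcs opposite
-- to a vertex v is the one absent from the umbrella of v; this colour is constant on
-- vertex orbits and separates them.
module Submission where

open import Defs
open import Data.Product using (_×_; Σ-syntax; ∃-syntax; ∃₂; _,_; proj₁; proj₂)
open import Data.Fin.Base using (Fin; zero; suc; toℕ; fromℕ; inject₁)
import Data.Fin.Properties as Fin
open import Data.Fin.Induction using (<-weakInduction; <-weakInduction-startingFrom)
open import Data.Fin.Subset using (Subset; _∈_; _⊆_; _∩_; _∪_; ⁅_⁆; ∣_∣)
open import Data.Fin.Subset.Properties
  using (x∈⁅x⁆; x∈⁅y⁆⇒x≡y; x∈p∪q⁻; p⊆p∪q; q⊆p∪q; p∩q⊆p; p∩q⊆q; x∈p∩q⁺; ⊆-refl; ⊆-trans;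
         p⊆q⇒∣p∣≤∣q∣; p⊂q⇒∣p∣<∣q∣; ∣p∣≤n; anySubset?; ⊆-antisym; _∈?_; _⊂?_)
open import Data.Bool.Base using (T; true; false)
open import Data.Bool.Properties using (T?)
open import Data.Nat.Base using (ℕ; zero; suc; _%_; _≤_; _<_; _∸_; s≤s; s≤s⁻¹)
import Data.Nat.Properties as ℕ
open import Data.Nat.DivMod using (m<n⇒m%n≡m; m%n<n; n%n≡0)
open import Data.Sum.Base using (_⊎_; inj₁; inj₂; [_,_]′)
open import Data.Vec.Base using ([]; _∷_; here; there; lookup)
open import Function.Base using (_∘_)
open import Function.Bundles using (_⇔_; mk⇔; mk↔ₛ′; Inverse; Equivalence)
open import Function.Construct.Composition using (_↔-∘_)
open import Function.Construct.Identity using (↔-id)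
open import Function.Construct.Symmetry using (↔-sym)
open import Function.Definitions using (Injective)
open import Level using (0ℓ)
open import Relation.Binary.Bundles using (Setoid)
open import Relation.Binary.PropositionalEquality
  using (_≡_; _≢_; refl; sym; trans; cong; subst; subst₂) renaming (setoid to ≡-setoid)
open import Relation.Nullary using (¬_; yes; no; contradiction)
open import Relation.Nullary.Decidable using (_×-dec_; decidable-stable)
open import Relation.Unary using (Pred)

open Inverse using (to; from; to-cong; strictlyInverseˡ; strictlyInverseʳ)
open PermutationGroup using (Element; elements; Transitive; orbits)

-- Bijections from setoids.

module _ {S : Setoid 0ℓ 0ℓ} {B : Set} where
  open Setoid S using (Carrier; _≈_)

  to-injective : (i : Inverse S (≡-setoid B)) → ∀ {x y} → to i x ≡ to i y → x ≈ y
  to-injective i eq = Setoid.trans S (Setoid.sym S (strictlyInverseʳ i _)) (Inverse.inverseʳ i eq)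

  -- All cardinalities below are obtained this way: the target carries propositional equality, so an
  -- arbitrary choice of preimages automatically respects it.
  inverse-from-section : (f : Carrier → B) → (∀ {x y} → x ≈ y → f x ≡ f y) →
    (∀ {x y} → f x ≡ f y → x ≈ y) → (∀ b → ∃[ x ] f x ≡ b) → Inverse S (≡-setoid B)
  inverse-from-section f f-cong f-inj section = record
    { to        = f
    ; from      = proj₁ ∘ section
    ; to-cong   = f-cong
    ; from-cong = λ { refl → Setoid.refl S }
    ; inverse   = (λ eq → trans (f-cong eq) (proj₂ (section _)))
                , (λ { refl → f-inj (proj₂ (section _)) })
    }

-- Cyclic index sets.

next-inject₁ : ∀ {m} (i : Fin m) → next (inject₁ i) ≡ suc i
next-inject₁ {m} i = Fin.toℕ-injective (trans
  (Fin.toℕ-fromℕ< (m%n<n (suc (toℕ (inject₁ i))) (suc m)))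
  (trans (cong (λ k → suc k % suc m) (Fin.toℕ-inject₁ i)) (m<n⇒m%n≡m (s≤s (Fin.toℕ<n i)))))

next-fromℕ : ∀ m → next (fromℕ m) ≡ zero
next-fromℕ m = Fin.toℕ-injective (trans
  (Fin.toℕ-fromℕ< (m%n<n (suc (toℕ (fromℕ m))) (suc m)))
  (trans (cong (λ k → suc k % suc m) (Fin.toℕ-fromℕ m)) (n%n≡0 (suc m))))

-- From `i` one climbs to the last index, wraps around to `zero`, and climbs from there to every
-- index.
next-induction : ∀ {n} (P : Pred (Fin n) 0ℓ) → (∀ i → P i → P (next i)) →
                 ∀ {i} → P i → ∀ j → P j
next-induction {suc m} P step {i} p = <-weakInduction P P-zero P-suc
  where
  P-suc : ∀ j → P (inject₁ j) → P (suc j)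
  P-suc j q = subst P (next-inject₁ j) (step _ q)
  P-zero : P zero
  P-zero = subst P (next-fromℕ m) (step _
    (<-weakInduction-startingFrom P p P-suc (Fin.≤fromℕ i)))

next-surjective : ∀ {n} (i : Fin n) → ∃[ j ] next j ≡ i
next-surjective = Fin-surjective next next-injective

-- Otherwise `i` and `next i` would be closed under `next` and exhaust the index set, which has at
-- least three elements.
next∘next≢id : ∀ {n} → 3 ≤ n → (i : Fin n) → next (next i) ≢ i
next∘next≢id (s≤s (s≤s (s≤s _))) i eq = clash (all zero) (all (suc zero)) (all (suc (suc zero)))
  where
  all : ∀ j → j ≡ i ⊎ j ≡ next i
  all = next-induction _ (λ { _ (inj₁ refl) → inj₂ refl ; _ (inj₂ refl) → inj₁ eq }) (inj₁ refl)
  clash : ∀ {k l} → zero ≡ k ⊎ zero ≡ l → suc zero ≡ k ⊎ suc zero ≡ l →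
          ¬ (suc (suc zero) ≡ k ⊎ suc (suc zero) ≡ l)
  clash (inj₁ refl) (inj₁ ())
  clash (inj₁ refl) (inj₂ refl) (inj₁ ())
  clash (inj₁ refl) (inj₂ refl) (inj₂ ())
  clash (inj₂ refl) (inj₁ refl) (inj₁ ())
  clash (inj₂ refl) (inj₁ refl) (inj₂ ())
  clash (inj₂ refl) (inj₂ ())

first : ∀ {n} → 3 ≤ n → Fin n
first (s≤s _) = zero

-- Three-element sets and finite subsets.

triple-injective : ∀ {A : Set} {a b c : A} → a ≢ b → a ≢ c → b ≢ c →
                   Injective _≡_ _≡_ (lookup (a ∷ b ∷ c ∷ []))
triple-injective a≢b a≢c b≢c {zero}         {zero}         eq = refl
triple-injective a≢b a≢c b≢c {zero}         {suc zero}     eq = contradiction eq a≢b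
triple-injective a≢b a≢c b≢c {zero}         {suc (suc zero)} eq = contradiction eq a≢c
triple-injective a≢b a≢c b≢c {suc zero}     {zero}         eq = contradiction (sym eq) a≢b
triple-injective a≢b a≢c b≢c {suc zero}     {suc zero}     eq = refl
triple-injective a≢b a≢c b≢c {suc zero}     {suc (suc zero)} eq = contradiction eq b≢c
triple-injective a≢b a≢c b≢c {suc (suc zero)} {zero}         eq = contradiction (sym eq) a≢c
triple-injective a≢b a≢c b≢c {suc (suc zero)} {suc zero}     eq = contradiction (sym eq) b≢c
triple-injective a≢b a≢c b≢c {suc (suc zero)} {suc (suc zero)} eq = refl

one-of-three : {a b c : Fin 3} → a ≢ b → a ≢ c → b ≢ c → ∀ d → d ≡ a ⊎ d ≡ b ⊎ d ≡ c
one-of-three {a} {b} {c} a≢b a≢c b≢c d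
  with Fin-surjective (lookup (a ∷ b ∷ c ∷ [])) (triple-injective a≢b a≢c b≢c) d
... | zero           , eq = inj₁ (sym eq)
... | suc zero       , eq = inj₂ (inj₁ (sym eq))
... | suc (suc zero) , eq = inj₂ (inj₂ (sym eq))

third-unique : {a b c d : Fin 3} → a ≢ b → c ≢ a → c ≢ b → d ≢ a → d ≢ b → c ≡ d
third-unique {d = d} a≢b c≢a c≢b d≢a d≢b
  with one-of-three a≢b (c≢a ∘ sym) (c≢b ∘ sym) d
... | inj₁ d≡a        = contradiction d≡a d≢a
... | inj₂ (inj₁ d≡b) = contradiction d≡b d≢b
... | inj₂ (inj₂ d≡c) = sym d≡c

-- The arguments may coincide; `other-vertices` starts from that case.
∃-third : (a b : Fin 3) → ∃[ c ] c ≢ a × c ≢ b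
∃-third zero             zero             = suc zero , (λ ()) , λ ()
∃-third zero             (suc zero)       = suc (suc zero) , (λ ()) , λ ()
∃-third zero             (suc (suc zero)) = suc zero , (λ ()) , λ ()
∃-third (suc zero)       zero             = suc (suc zero) , (λ ()) , λ ()
∃-third (suc zero)       (suc zero)       = zero , (λ ()) , λ ()
∃-third (suc zero)       (suc (suc zero)) = zero , (λ ()) , λ ()
∃-third (suc (suc zero)) zero             = suc zero , (λ ()) , λ ()
∃-third (suc (suc zero)) (suc zero)       = zero , (λ ()) , λ ()
∃-third (suc (suc zero)) (suc (suc zero)) = zero , (λ ()) , λ ()

-- A section of `f` is injective, hence by finiteness surjective, so every argument of `f` is a
-- chosen preimage and is determined by its value.
surjective⇒injective : ∀ {n} (f : Fin n → Fin n) → (∀ y → ∃[ x ] f x ≡ y) → Injective _≡_ _≡_ f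
surjective⇒injective f surj {x} {y} fx≡fy
  with Fin-surjective g g-injective x | Fin-surjective g g-injective y
  where
  g = proj₁ ∘ surj
  g-injective : Injective _≡_ _≡_ g
  g-injective {a} {b} eq = trans (sym (proj₂ (surj a))) (trans (cong f eq) (proj₂ (surj b)))
... | a , refl | b , refl =
  cong (proj₁ ∘ surj) (trans (sym (proj₂ (surj a))) (trans fx≡fy (proj₂ (surj b))))

∃elements : ∀ {n} (s : Subset n) → Σ[ f ∈ (Fin ∣ s ∣ → Fin n) ]
            Injective _≡_ _≡_ f × (∀ x → x ∈ s ⇔ (∃[ k ] f k ≡ x))
∃elements []          = (λ ()) , (λ { {()} }) , λ ()
∃elements (false ∷ s) with ∃elements s
... | f , f-inj , enum = suc ∘ f , f-inj ∘ Fin.suc-injective , λ where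
  zero    → mk⇔ (λ ()) (λ ())
  (suc x) → mk⇔
    (λ { (there x∈s) → let k , eq = Equivalence.to (enum x) x∈s in k , cong suc eq })
    (λ (k , eq) → there (Equivalence.from (enum x) (k , Fin.suc-injective eq)))
∃elements (true ∷ s)  with ∃elements s
... | f , f-inj , enum = f⁺ , f⁺-inj , λ where
    zero    → mk⇔ (λ _ → zero , refl) (λ _ → here)
    (suc x) → mk⇔
      (λ { (there x∈s) → let k , eq = Equivalence.to (enum x) x∈s in suc k , cong suc eq })
      (λ { (suc k , eq) → there (Equivalence.from (enum x) (k , Fin.suc-injective eq)) })
  where
  f⁺ : Fin (suc ∣ s ∣) → Fin _
  f⁺ zero    = zero
  f⁺ (suc k) = suc (f k)
  f⁺-inj : Injective _≡_ _≡_ f⁺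
  f⁺-inj {zero}  {zero}  eq = refl
  f⁺-inj {suc k} {suc l} eq = cong suc (f-inj (Fin.suc-injective eq))

⊆∧∣≡∣⇒⊇ : ∀ {n} {s t : Subset n} → s ⊆ t → ∣ s ∣ ≡ ∣ t ∣ → t ⊆ s
⊆∧∣≡∣⇒⊇ {s = s} s⊆t eq {x} x∈t = decidable-stable (x ∈? s) λ x∉s →
  ℕ.<⇒≢ (p⊂q⇒∣p∣<∣q∣ (s⊆t , x , x∈t , x∉s)) eq

-- Chordless cycles are determined by their nodes.

module _ {G : Graph} where
  open Graph G

  -- Consecutive nodes of c occupy adjacent positions of d, and since c does not
  -- turn back the direction in which d is traversed never changes.
  chordless-unique : (c d : Cycle G) → Chordless G d →
    (∀ i → ∃[ j ] node d j ≡ node c i) → (∀ j → ∃[ i ] node c i ≡ node d j) →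
    Setoid._≈_ (cycles G) c d
  chordless-unique c d chordless c⊆d d⊆c = record
    { shift     = mk↔ₛ′ σ τ
        (λ j → injective d (trans (proj₂ (c⊆d (τ j))) (proj₂ (d⊆c j))))
        (λ i → injective c (trans (proj₂ (d⊆c (σ i))) (proj₂ (c⊆d i))))
    ; dihedral  = dihedral
    ; same-node = λ i → sym (proj₂ (c⊆d i))
    }
    where
    σ : Fin (length c) → Fin (length d)
    σ i = proj₁ (c⊆d i)
    τ : Fin (length d) → Fin (length c)
    τ j = proj₁ (d⊆c j)

    σ-injective : Injective _≡_ _≡_ σ
    σ-injective {i} {j} eq = injective c
      (trans (sym (proj₂ (c⊆d i))) (trans (cong (node d) eq) (proj₂ (c⊆d j))))

    Forward Backward : Pred (Fin (length c)) 0ℓ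
    Forward i  = σ (next i) ≡ next (σ i)
    Backward i = σ i ≡ next (σ (next i))

    direction : ∀ i → Forward i ⊎ Backward i
    direction i = chordless (σ i) (σ (next i))
      (subst₂ _~_ (sym (proj₂ (c⊆d i))) (sym (proj₂ (c⊆d (next i)))) (step c i))

    no-return : ∀ i → σ (next (next i)) ≢ σ i
    no-return i eq = next∘next≢id (3≤length c) i (σ-injective eq)

    forward-step : ∀ i → Forward i → Forward (next i)
    forward-step i fwd with direction (next i)
    ... | inj₁ fwd′ = fwd′
    ... | inj₂ bwd′ = contradiction (next-injective (trans (sym bwd′) fwd)) (no-return i)

    backward-step : ∀ i → Backward i → Backward (next i)
    backward-step i bwd with direction (next i)
    ... | inj₁ fwd′ = contradiction (trans fwd′ (sym bwd)) (no-return i)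
    ... | inj₂ bwd′ = bwd′

    dihedral : (∀ i → σ (next i) ≡ next (σ i)) ⊎ (∀ i → next (σ (next i)) ≡ σ i)
    dihedral with direction (first (3≤length c))
    ... | inj₁ fwd = inj₁ (next-induction Forward forward-step fwd)
    ... | inj₂ bwd = inj₂ (sym ∘ next-induction Backward backward-step bwd)

-- Vertices, edges and faces of a simplicial surface.

module Incidence (X : SimplicialSurface) where
  open SimplicialSurface X

  abstract
    -- The fuel `k` bounds the number of ground points outside `s`, which drops with each passage to
    -- a strictly larger simplex. When none exists, `s` is maximal and purity applies.
    extends-to-triple : ∀ k s → T (member s) → groundSize ∸ ∣ s ∣ < k →
                        ∃[ t ] T (member t) × s ⊆ t × ∣ t ∣ ≡ 3
    extends-to-triple (suc k) s s∈X s<k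
      with anySubset? (λ t → T? (member t) ×-dec (s ⊂? t))
    ... | yes (t , t∈X , s⊂t) =
          let u , u∈X , t⊆u , ∣u∣≡3 = extends-to-triple k t t∈X
                (ℕ.<-≤-trans (ℕ.∸-monoʳ-< (p⊂q⇒∣p∣<∣q∣ s⊂t) (∣p∣≤n t)) (s≤s⁻¹ s<k))
          in u , u∈X , ⊆-trans (proj₁ s⊂t) t⊆u , ∣u∣≡3
    ... | no maximal = s , s∈X , ⊆-refl , pure s s∈X λ t t∈X s⊆t → ⊆-antisym s⊆t λ {x} x∈t →
          decidable-stable (x ∈? s) λ x∉s → maximal (t , t∈X , s⊆t , x , x∈t , x∉s)

    ∃face : ∀ s → T (member s) → Σ[ F ∈ Face ] s ⊆ support F
    ∃face s s∈X = let t , t∈X , s⊆t , ∣t∣≡3 = extends-to-triple _ s s∈X (ℕ.n<1+n _)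
                  in simplex t t∈X ∣t∣≡3 , s⊆t

    someFace : Face
    someFace = proj₁ (∃face (proj₁ nonempty) (proj₂ nonempty))

    ∃face∋ : (v : Vertex) → Σ[ F ∈ Face ] v ⊑ F
    ∃face∋ v = let F , v⊆F = ∃face (support v) (isMember v) in F , sub v⊆F

    ∃vertices : ∀ {i} (s : Simplex i) → Σ[ f ∈ (Fin (suc i) → Vertex) ]
                Injective _≡_ _≡_ f × ((v : Vertex) → v ⊑ s ⇔ (∃[ k ] f k ≡ v))
    -- Abstracting the cardinality together with `dimension s` lets `refl` turn the index set of the
    -- enumeration into `Fin (suc i)`.
    ∃vertices {i} s with ∣ support s ∣ | dimension s | ∃elements (support s)
    ... | _ | refl | f , f-inj , enum = g , g-inj , λ v → mk⇔ (toIndex v) (fromIndex v)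
      where
      f∈s : ∀ k → f k ∈ support s
      f∈s k = Equivalence.from (enum (f k)) (k , refl)
      g : Fin (suc i) → Vertex
      g k = vertexAt s (f∈s k)
      g-inj : Injective _≡_ _≡_ g
      g-inj {k} {l} eq = f-inj (x∈⁅y⁆⇒x≡y (f l) (subst (f k ∈_) (cong support eq) (x∈⁅x⁆ (f k))))
      toIndex : (v : Vertex) → v ⊑ s → ∃[ k ] g k ≡ v
      toIndex v v⊑s with vertex-point v
      ... | x , v≡x with Equivalence.to (enum x) (incl v⊑s (subst (x ∈_) (sym v≡x) (x∈⁅x⁆ x)))
      ... | k , refl = k , simplex-≡ (sym v≡x)
      fromIndex : (v : Vertex) → (∃[ k ] g k ≡ v) → v ⊑ s
      fromIndex _ (k , refl) = sub (⁅⁆⊆ (f∈s k))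

    module _ (F : Face) where
      corner : Fin 3 → Vertex
      corner = proj₁ (∃vertices F)

      corner-injective : Injective _≡_ _≡_ corner
      corner-injective = proj₁ (proj₂ (∃vertices F))

      corner⊑ : ∀ k → corner k ⊑ F
      corner⊑ k = Equivalence.from (proj₂ (proj₂ (∃vertices F)) _) (k , refl)

      cornerIndex : {v : Vertex} → v ⊑ F → ∃[ k ] corner k ≡ v
      cornerIndex {v} = Equivalence.to (proj₂ (proj₂ (∃vertices F)) v)

      other-vertices : {v : Vertex} → v ⊑ F → ∃₂ λ (x y : Vertex) → x ≢ y × x ≢ v × y ≢ v × x ⊑ F × y ⊑ F
      other-vertices v⊑F with cornerIndex v⊑F
      ... | k , refl = let a , a≢k , _ = ∃-third k k
                           b , b≢k , b≢a = ∃-third k a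
                       in corner a , corner b , b≢a ∘ sym ∘ corner-injective ,
                          a≢k ∘ corner-injective , b≢k ∘ corner-injective , corner⊑ a , corner⊑ b

      one-of-three-vertices : {a b c d : Vertex} → a ⊑ F → b ⊑ F → c ⊑ F → d ⊑ F →
        a ≢ b → a ≢ c → b ≢ c → d ≡ a ⊎ d ≡ b ⊎ d ≡ c
      one-of-three-vertices a⊑ b⊑ c⊑ d⊑ a≢b a≢c b≢c
        with cornerIndex a⊑ | cornerIndex b⊑ | cornerIndex c⊑ | cornerIndex d⊑
      ... | i , refl | j , refl | k , refl | l , refl
        with one-of-three {i} {j} {k} (a≢b ∘ cong corner) (a≢c ∘ cong corner) (b≢c ∘ cong corner) l
      ... | inj₁ refl        = inj₁ refl
      ... | inj₂ (inj₁ refl) = inj₂ (inj₁ refl)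
      ... | inj₂ (inj₂ refl) = inj₂ (inj₂ refl)

    ⊑⇒≡ : ∀ {i} {s t : Simplex i} → s ⊑ t → s ≡ t
    ⊑⇒≡ {s = s} {t} s⊑t = simplex-≡ (⊆-antisym (incl s⊑t)
      (⊆∧∣≡∣⇒⊇ (incl s⊑t) (trans (dimension s) (sym (dimension t)))))

    module _ {F : Face} {x y : Vertex} (x≢y : x ≢ y) (x⊑F : x ⊑ F) (y⊑F : y ⊑ F) where
      edge : Edge
      edge with vertex-point x | vertex-point y
      ... | a , x≡a | b , y≡b = simplex (⁅ a ⁆ ∪ ⁅ b ⁆)
          (downward-closed (isMember F) λ z∈ →
            [ subst (_⊆ support F) x≡a (incl x⊑F) , subst (_⊆ support F) y≡b (incl y⊑F) ]′ (x∈p∪q⁻ ⁅ a ⁆ ⁅ b ⁆ z∈))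
          (∣pair∣≡2 a b λ { refl → x≢y (simplex-≡ (trans x≡a (sym y≡b))) })

      edge⊑ : {K : Face} → x ⊑ K → y ⊑ K → edge ⊑ K
      edge⊑ x⊑K y⊑K with vertex-point x | vertex-point y
      ... | a , refl | b , refl = sub λ z∈ → [ incl x⊑K , incl y⊑K ]′ (x∈p∪q⁻ ⁅ a ⁆ ⁅ b ⁆ z∈)

      ⊑edge : {K : Face} → edge ⊑ K → x ⊑ K × y ⊑ K
      ⊑edge e⊑K with vertex-point x | vertex-point y
      ... | a , refl | b , refl =
        sub (incl e⊑K ∘ p⊆p∪q ⁅ b ⁆) , sub (incl e⊑K ∘ q⊆p∪q ⁅ a ⁆ ⁅ b ⁆)

      -- `F` and `G` already fill both places among the two faces at the edge joining `x` and `y`.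
      third-face : {G K : Face} → F ≢ G → x ⊑ G → y ⊑ G → x ⊑ K → y ⊑ K → K ≡ F ⊎ K ≡ G
      third-face {G} {K} F≢G x⊑G y⊑G x⊑K y⊑K =
        decide _ _ _ (F≢G ∘ to-injective faces {F , edge⊑ x⊑F y⊑F} {G , edge⊑ x⊑G y⊑G})
          (to-injective faces {K , edge⊑ x⊑K y⊑K}) (to-injective faces)
        where
        faces : HasCardinality (Restrict (≡-setoid Face) (edge ⊑_)) 2
        faces = edge-in-two-faces edge
        decide : ∀ {A B : Set} (i j k : Fin 2) → i ≢ j → (k ≡ i → A) → (k ≡ j → B) → A ⊎ B
        decide zero       zero       _          i≢j _ _ = contradiction refl i≢j
        decide (suc zero) (suc zero) _          i≢j _ _ = contradiction refl i≢j
        decide zero       _          zero       _ a _ = inj₁ (a refl)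
        decide (suc zero) _          (suc zero) _ a _ = inj₁ (a refl)
        decide _          zero       zero       _ _ b = inj₂ (b refl)
        decide _          (suc zero) (suc zero) _ _ b = inj₂ (b refl)

    module _ {F G : Face} (F~G : F adjacentTo G) where
      common-vertices : ∃₂ λ (x y : Vertex) → x ≢ y × x ⊑ F × y ⊑ F × x ⊑ G × y ⊑ G
      common-vertices with proj₂ F~G
      ... | e , e⊑F , e⊑G with ∃vertices e
      ... | f , f-inj , enum = f zero , f (suc zero) , (λ eq → contradiction (f-inj eq) λ ()) ,
          f⊑ zero e⊑F , f⊑ (suc zero) e⊑F , f⊑ zero e⊑G , f⊑ (suc zero) e⊑G
        where
        f⊑ : ∀ k {K : Face} → e ⊑ K → f k ⊑ K
        f⊑ k e⊑K = sub (incl e⊑K ∘ incl (Equivalence.from (enum (f k)) (k , refl)))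

      -- If `G` contained every corner of `F`, equal cardinality would force `F ≡ G`.
      ∃missed : Σ[ v ∈ Vertex ] v ⊑ F × ¬ v ⊑ G
      ∃missed with Fin.all? (λ k → corner F k ⊑? G)
      ... | yes all⊑ = contradiction (⊑⇒≡ (⊑-from-vertices F G λ v v⊑F →
              let k , eq = cornerIndex F v⊑F in subst (_⊑ G) eq (all⊑ k))) (proj₁ F~G)
      ... | no ¬all⊑ = let k , k⋢ = Fin.¬∀⟶∃¬ 3 _ (λ k → corner F k ⊑? G) ¬all⊑ in
              corner F k , corner⊑ F k , k⋢

      -- The two ends of the shared edge leave only one corner of `F`.
      missed-unique : {v w : Vertex} → v ⊑ F → ¬ v ⊑ G → w ⊑ F → ¬ w ⊑ G → w ≡ v
      missed-unique v⊑F v⋢G w⊑F w⋢G with common-vertices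
      ... | x , y , x≢y , x⊑F , y⊑F , x⊑G , y⊑G
        with one-of-three-vertices F x⊑F y⊑F v⊑F w⊑F x≢y (λ { refl → v⋢G x⊑G }) (λ { refl → v⋢G y⊑G })
      ... | inj₁ refl        = contradiction x⊑G w⋢G
      ... | inj₂ (inj₁ refl) = contradiction y⊑G w⋢G
      ... | inj₂ (inj₂ w≡v)  = w≡v

      others-shared : {v w : Vertex} → v ⊑ F → ¬ v ⊑ G → w ⊑ F → w ≢ v → w ⊑ G
      others-shared {w = w} v⊑F v⋢G w⊑F w≢v =
        decidable-stable (w ⊑? G) (w≢v ∘ missed-unique v⊑F v⋢G w⊑F)

    share-two⇒adjacent : {F G : Face} {x y : Vertex} → F ≢ G → x ≢ y → x ⊑ F → y ⊑ F → x ⊑ G → y ⊑ G → F adjacentTo G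
    share-two⇒adjacent F≢G x≢y x⊑F y⊑F x⊑G y⊑G =
      F≢G , edge x≢y x⊑F y⊑F , edge⊑ x≢y x⊑F y⊑F x⊑F y⊑F , edge⊑ x≢y x⊑F y⊑F x⊑G y⊑G

    ~-sym : {F G : Face} → F adjacentTo G → G adjacentTo F
    ~-sym = Graph.~-sym ℱ

    -- One of the two faces at the edge opposite to `v` differs from `F`. It contains the other two
    -- corners, so the corner that it must miss is `v`.
    ∃mate : {F : Face} {v : Vertex} → v ⊑ F → Σ[ G ∈ Face ] F adjacentTo G × ¬ v ⊑ G
    ∃mate {F} {v} v⊑F with other-vertices F v⊑F
    ... | x , y , x≢y , x≢v , y≢v , x⊑F , y⊑F = other (from faces zero) (from faces (suc zero))
          λ eq → contradiction (trans (sym (strictlyInverseˡ faces zero))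
            (trans (to-cong faces eq) (strictlyInverseˡ faces (suc zero)))) λ ()
      where
      faces : HasCardinality (Restrict (≡-setoid Face) (edge x≢y x⊑F y⊑F ⊑_)) 2
      faces = edge-in-two-faces (edge x≢y x⊑F y⊑F)
      mate : ∀ G → F ≢ G → edge x≢y x⊑F y⊑F ⊑ G → Σ[ G ∈ Face ] F adjacentTo G × ¬ v ⊑ G
      mate G F≢G e⊑G with ⊑edge x≢y x⊑F y⊑F e⊑G
      ... | x⊑G , y⊑G = G , F~G , avoids (∃missed F~G)
        where
        F~G : F adjacentTo G
        F~G = share-two⇒adjacent F≢G x≢y x⊑F y⊑F x⊑G y⊑G
        avoids : (Σ[ m ∈ Vertex ] m ⊑ F × ¬ m ⊑ G) → ¬ v ⊑ G
        avoids (m , m⊑F , m⋢G) v⊑G with one-of-three-vertices F x⊑F y⊑F v⊑F m⊑F x≢y x≢v y≢v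
        ... | inj₁ refl        = m⋢G x⊑G
        ... | inj₂ (inj₁ refl) = m⋢G y⊑G
        ... | inj₂ (inj₂ refl) = m⋢G v⊑G
      other : (G₁ G₂ : Σ[ G ∈ Face ] edge x≢y x⊑F y⊑F ⊑ G) → proj₁ G₁ ≢ proj₁ G₂ →
              Σ[ G ∈ Face ] F adjacentTo G × ¬ v ⊑ G
      other (G₁ , e⊑G₁) (G₂ , e⊑G₂) G₁≢G₂ with F ≟ˢ G₁
      ... | no F≢G₁  = mate G₁ F≢G₁ e⊑G₁
      ... | yes refl = mate G₂ G₁≢G₂ e⊑G₂

    -- Both neighbours contain the edge of `F` opposite to `v`, where `F` leaves room for one
    -- further face.
    mate-unique : {F G G′ : Face} {v : Vertex} → F adjacentTo G → F adjacentTo G′ →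
                  v ⊑ F → ¬ v ⊑ G → ¬ v ⊑ G′ → G′ ≡ G
    mate-unique {F} F~G F~G′ v⊑F v⋢G v⋢G′ with other-vertices F v⊑F
    ... | x , y , x≢y , x≢v , y≢v , x⊑F , y⊑F
      with third-face x≢y x⊑F y⊑F (proj₁ F~G)
             (others-shared F~G v⊑F v⋢G x⊑F x≢v) (others-shared F~G v⊑F v⋢G y⊑F y≢v)
             (others-shared F~G′ v⊑F v⋢G′ x⊑F x≢v) (others-shared F~G′ v⊑F v⋢G′ y⊑F y≢v)
    ... | inj₁ refl  = contradiction refl (proj₁ F~G′)
    ... | inj₂ G′≡G  = G′≡G

    -- In F only two vertices other than v can be missed by a neighbour of F through v.
    two-neighbours-at : {F G₁ G₂ G : Face} {v : Vertex} → F adjacentTo G₁ → F adjacentTo G₂ → G₁ ≢ G₂ → F adjacentTo G →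
      v ⊑ F → v ⊑ G₁ → v ⊑ G₂ → v ⊑ G → G ≡ G₁ ⊎ G ≡ G₂
    two-neighbours-at {F} F~G₁ F~G₂ G₁≢G₂ F~G v⊑F v⊑G₁ v⊑G₂ v⊑G
      with ∃missed F~G₁ | ∃missed F~G₂ | ∃missed F~G
    ... | a , a⊑F , a⋢G₁ | b , b⊑F , b⋢G₂ | m , m⊑F , m⋢G
      with one-of-three-vertices F a⊑F b⊑F v⊑F m⊑F
             (λ { refl → G₁≢G₂ (sym (mate-unique F~G₁ F~G₂ a⊑F a⋢G₁ b⋢G₂)) })
             (λ { refl → a⋢G₁ v⊑G₁ }) (λ { refl → b⋢G₂ v⊑G₂ })
    ... | inj₁ refl        = inj₁ (mate-unique F~G₁ F~G a⊑F a⋢G₁ m⋢G)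
    ... | inj₂ (inj₁ refl) = inj₂ (mate-unique F~G₂ F~G b⊑F b⋢G₂ m⋢G)
    ... | inj₂ (inj₂ refl) = contradiction v⊑G m⋢G

    -- If `v` and `w` differed, a face through both would have a neighbour missing only `w`, hence
    -- containing `v` without `w`.
    faces-determine-vertex : {v w : Vertex} → ((F : Face) → v ⊑ F → w ⊑ F) → v ≡ w
    faces-determine-vertex {v} {w} h = decidable-stable (v ≟ˢ w) λ v≢w →
      let F , v⊑F       = ∃face∋ v
          G , F~G , w⋢G = ∃mate (h F v⊑F)
      in w⋢G (h G (others-shared F~G (h F v⊑F) w⋢G v⊑F v≢w))

  missed : {F G : Face} → F adjacentTo G → Vertex
  missed = proj₁ ∘ ∃missed

  -- Neighbours of `F` are numbered by the corner of `F` that they miss.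
  cubic : Cubic ℱ
  cubic F = inverse-from-section index index-cong index-injective index-section
    where
    index : Σ[ G ∈ Face ] F adjacentTo G → Fin 3
    index (G , F~G) = proj₁ (cornerIndex F (proj₁ (proj₂ (∃missed F~G))))
    corner-index : ∀ N → corner F (index N) ≡ missed (proj₂ N)
    corner-index (G , F~G) = proj₂ (cornerIndex F (proj₁ (proj₂ (∃missed F~G))))
    -- The missed corner is extracted from the adjacency proof, whereas neighbours are compared as
    -- faces only; `missed-unique` bridges the gap.
    index-cong : ∀ {N N′} → proj₁ N ≡ proj₁ N′ → index N ≡ index N′
    index-cong {G , F~G} {G , F~G′} refl with ∃missed F~G | ∃missed F~G′
    ... | a , a⊑F , a⋢G | b , b⊑F , b⋢G =
      corner-injective F (trans (proj₂ (cornerIndex F a⊑F))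
        (trans (missed-unique F~G b⊑F b⋢G a⊑F a⋢G) (sym (proj₂ (cornerIndex F b⊑F)))))
    index-injective : ∀ {N N′} → index N ≡ index N′ → proj₁ N ≡ proj₁ N′
    index-injective {N@(G , F~G)} {N′@(G′ , F~G′)} eq =
      mate-unique F~G′ F~G (proj₁ (proj₂ (∃missed F~G′))) (proj₂ (proj₂ (∃missed F~G′)))
        (subst (λ v → ¬ v ⊑ G)
          (trans (sym (corner-index N)) (trans (cong (corner F) eq) (corner-index N′)))
          (proj₂ (proj₂ (∃missed F~G))))
    index-section : ∀ k → ∃[ N ] index N ≡ k
    index-section k with ∃mate (corner⊑ F k)
    ... | G , F~G , k⋢G = (G , F~G) , corner-injective F (trans (corner-index (G , F~G))
          (missed-unique F~G (corner⊑ F k) k⋢G (proj₁ (proj₂ (∃missed F~G))) (proj₂ (proj₂ (∃missed F~G)))))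

  consecutive⇒adjacent : ∀ (F G : Face) → ∣ support F ∩ support G ∣ ≡ 2 → F adjacentTo G
  consecutive⇒adjacent F G eq = F≢G ,
    simplex (support F ∩ support G) (downward-closed (isMember F) (p∩q⊆p (support F) (support G))) eq ,
    sub (p∩q⊆p (support F) (support G)) , sub (p∩q⊆q (support F) (support G))
    where
    F≢G : F ≢ G
    F≢G refl = contradiction
      (ℕ.≤-trans (ℕ.≤-reflexive (sym (dimension F)))
        (ℕ.≤-trans (p⊆q⇒∣p∣≤∣q∣ {p = support F} (λ x∈F → x∈p∩q⁺ (x∈F , x∈F))) (ℕ.≤-reflexive eq)))
      (ℕ.<⇒≱ (ℕ.n<1+n 2))

  adjacent⇒consecutive : {F G : Face} → F adjacentTo G → ∣ support F ∩ support G ∣ ≡ 2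
  adjacent⇒consecutive {F} {G} (F≢G , e , e⊑F , e⊑G) = ℕ.≤-antisym
    (s≤s⁻¹ (subst (∣ support F ∩ support G ∣ <_) (dimension F) (ℕ.≤∧≢⇒< (p⊆q⇒∣p∣≤∣q∣ ∩⊆F) ∣∩∣≢∣F∣)))
    (subst (_≤ ∣ support F ∩ support G ∣) (dimension e)
      (p⊆q⇒∣p∣≤∣q∣ (λ x∈e → x∈p∩q⁺ (incl e⊑F x∈e , incl e⊑G x∈e))))
    where
    ∩⊆F = p∩q⊆p (support F) (support G)
    ∣∩∣≢∣F∣ : ∣ support F ∩ support G ∣ ≢ ∣ support F ∣
    ∣∩∣≢∣F∣ eq = F≢G (⊑⇒≡ (sub (p∩q⊆q (support F) (support G) ∘ ⊆∧∣≡∣⇒⊇ ∩⊆F eq)))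

  -- These are the mates opposite to the two corners of `F` other than `v`.
  two-mates-at : {F : Face} {v : Vertex} → v ⊑ F → ∃₂ λ G₁ G₂ → G₁ ≢ G₂ ×
                 F adjacentTo G₁ × v ⊑ G₁ × F adjacentTo G₂ × v ⊑ G₂
  two-mates-at {F} v⊑F with other-vertices F v⊑F
  ... | x , y , x≢y , x≢v , y≢v , x⊑F , y⊑F with ∃mate x⊑F | ∃mate y⊑F
  ... | G₁ , F~G₁ , x⋢G₁ | G₂ , F~G₂ , y⋢G₂ = G₁ , G₂ ,
    (λ { refl → y⋢G₂ (others-shared F~G₁ x⊑F x⋢G₁ y⊑F (x≢y ∘ sym)) }) ,
    F~G₁ , others-shared F~G₁ x⊑F x⋢G₁ v⊑F (x≢v ∘ sym) ,
    F~G₂ , others-shared F~G₂ y⊑F y⋢G₂ v⊑F (y≢v ∘ sym)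

  -- Umbrellas as cycles of the face graph.

  open IsUmbrella

  -- A face at `v` and its two neighbours through `v` are three distinct entries. `IsUmbrella` sets
  -- no lower bound on the length, but `Cycle` does.
  umbrella-length : ∀ {v : Vertex} {n} {F : Fin n → Face} → IsUmbrella v F → 3 ≤ n
  umbrella-length {v} {n} {U} u with ∃face∋ v
  ... | F , v⊑F with two-mates-at v⊑F
  ... | G₁ , G₂ , G₁≢G₂ , F~G₁ , v⊑G₁ , F~G₂ , v⊑G₂ =
    Fin.injective⇒≤ (triple-injective (proj₁ F~G₁ ∘ index-injective v⊑F v⊑G₁)
      (proj₁ F~G₂ ∘ index-injective v⊑F v⊑G₂) (G₁≢G₂ ∘ index-injective v⊑G₁ v⊑G₂))
    where
    index : {G : Face} → v ⊑ G → Fin n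
    index v⊑G = proj₁ (Equivalence.to (enumerates u _) v⊑G)
    index-injective : {G G′ : Face} (p : v ⊑ G) (q : v ⊑ G′) → index p ≡ index q → G ≡ G′
    index-injective p q eq = trans (sym (proj₂ (Equivalence.to (enumerates u _) p)))
      (trans (cong U eq) (proj₂ (Equivalence.to (enumerates u _) q)))

  abstract
    umbrellaCycle : Vertex → Cycle ℱ
    umbrellaCycle v = let n , F , u = umbrella v in record
      { length    = n
      ; 3≤length  = umbrella-length u
      ; node      = F
      ; injective = once u
      ; step      = λ i → consecutive⇒adjacent (F i) (F (next i)) (consecutive u i)
      }

    umbrellaCycle-umbrella : ∀ v → IsUmbrella v (node (umbrellaCycle v))
    umbrellaCycle-umbrella v = proj₂ (proj₂ (umbrella v))

  -- The successor and the predecessor on `c` are distinct neighbours through `v`, and a face has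
  -- only two of these.
  neighbours-in-cycle : ∀ (c : Cycle ℱ) {v : Vertex} → (∀ i → v ⊑ node c i) →
    ∀ i {G} → node c i adjacentTo G → v ⊑ G → G ≡ node c (next i) ⊎ (∃[ j ] next j ≡ i × G ≡ node c j)
  neighbours-in-cycle c v⊑c i i~G v⊑G with next-surjective i
  ... | j , refl with two-neighbours-at (step c (next j)) (~-sym (step c j))
                       (next∘next≢id (3≤length c) j ∘ injective c) i~G
                       (v⊑c (next j)) (v⊑c (next (next j))) (v⊑c j) v⊑G
  ... | inj₁ eq = inj₁ eq
  ... | inj₂ eq = inj₂ (j , refl , eq)

  module _ {v : Vertex} {n} {U : Fin n → Face} (u : IsUmbrella v U) where
    v⊑node : ∀ i → v ⊑ U i
    v⊑node i = Equivalence.from (enumerates u _) (i , refl)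

    indexOf : {F : Face} → v ⊑ F → ∃[ i ] U i ≡ F
    indexOf = Equivalence.to (enumerates u _)

  module _ (c : Cycle ℱ) {v : Vertex} (u : IsUmbrella v (node c)) where
    umbrella-chordless : Chordless ℱ c
    umbrella-chordless i j i~j with neighbours-in-cycle c (v⊑node u) i i~j (v⊑node u j)
    ... | inj₁ eq            = inj₁ (injective c eq)
    ... | inj₂ (k , refl , eq) = inj₂ (cong next (sym (injective c eq)))

    ∈ᵃ⇒⊑ : ∀ e → _∈ᵃ_ ℱ e c → v ⊑ source e × v ⊑ target e
    ∈ᵃ⇒⊑ e (i , inj₁ (refl , refl)) = v⊑node u i , v⊑node u (next i)
    ∈ᵃ⇒⊑ e (i , inj₂ (refl , refl)) = v⊑node u (next i) , v⊑node u i

    ⊑⇒∈ᵃ : {F G : Face} (F~G : F adjacentTo G) → v ⊑ F → v ⊑ G → _∈ᵃ_ ℱ (arc F~G) c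
    ⊑⇒∈ᵃ F~G v⊑F v⊑G with indexOf u v⊑F | indexOf u v⊑G
    ... | i , refl | j , refl with umbrella-chordless i j F~G
    ... | inj₁ refl = i , inj₁ (refl , refl)
    ... | inj₂ refl = j , inj₂ (refl , refl)

  umbrella-unique : {v : Vertex} (c d : Cycle ℱ) → IsUmbrella v (node c) → IsUmbrella v (node d) →
                    Setoid._≈_ (cycles ℱ) c d
  umbrella-unique c d u u′ = chordless-unique c d (umbrella-chordless d u′)
    (λ i → indexOf u′ (v⊑node u i)) (λ j → indexOf u (v⊑node u′ j))

  umbrella-vertex-unique : (c d : Cycle ℱ) {v w : Vertex} → IsUmbrella v (node c) → IsUmbrella w (node d) →
                           Setoid._≈_ (cycles ℱ) c d → v ≡ w
  umbrella-vertex-unique c d {w = w} u u′ c≈d = faces-determine-vertex λ F v⊑F →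
    let i , eq = indexOf u v⊑F
    in subst (w ⊑_) (trans (sym (_≈ᶜ_.same-node c≈d i)) eq) (v⊑node u′ _)

  -- Walk along the given umbrella of `v`, starting at a face of `c`: each next face is a neighbour
  -- through `v`, so it lies on `c` again. Hence `c` meets every face at `v`.
  closed-cycle-umbrella : ∀ (c : Cycle ℱ) {v : Vertex} → (∀ i → v ⊑ node c i) → IsUmbrella v (node c)
  closed-cycle-umbrella c {v} v⊑c = record
    { once        = injective c
    ; enumerates  = λ G → mk⇔ (occurs G) (λ (i , eq) → subst (v ⊑_) eq (v⊑c i))
    ; consecutive = adjacent⇒consecutive ∘ step c
    }
    where
    d = umbrellaCycle v
    u = umbrellaCycle-umbrella v

    Occurs : Pred (Fin (length d)) 0ℓ
    Occurs j = ∃[ i ] node c i ≡ node d j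

    occurs-next : ∀ j → Occurs j → Occurs (next j)
    occurs-next j (i , eq)
      with neighbours-in-cycle c v⊑c i (subst (_adjacentTo node d (next j)) (sym eq) (step d j)) (v⊑node u (next j))
    ... | inj₁ eq′           = next i , sym eq′
    ... | inj₂ (k , _ , eq′) = k , sym eq′

    occurs : ∀ G → v ⊑ G → ∃[ i ] node c i ≡ G
    occurs G v⊑G with indexOf u v⊑G | indexOf u (v⊑c (first (3≤length c)))
    ... | j , refl | j₀ , eq = next-induction Occurs occurs-next (first (3≤length c) , sym eq) j

  -- All four faces contain the edge joining `v` and `w`, which lies in two faces only.
  same-arc : {F G F′ G′ : Face} {v w : Vertex} → v ≢ w →
             v ⊑ F → w ⊑ F → v ⊑ G → w ⊑ G → v ⊑ F′ → w ⊑ F′ → v ⊑ G′ → w ⊑ G′ →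
             F adjacentTo G → F′ adjacentTo G′ → SamePair ℱ F G F′ G′
  same-arc v≢w v⊑F w⊑F v⊑G w⊑G v⊑F′ w⊑F′ v⊑G′ w⊑G′ F~G F′~G′
    with third-face v≢w v⊑F w⊑F (proj₁ F~G) v⊑G w⊑G v⊑F′ w⊑F′
       | third-face v≢w v⊑F w⊑F (proj₁ F~G) v⊑G w⊑G v⊑G′ w⊑G′
  ... | inj₁ refl | inj₁ refl = contradiction refl (proj₁ F′~G′)
  ... | inj₁ refl | inj₂ refl = inj₁ (refl , refl)
  ... | inj₂ refl | inj₁ refl = inj₂ (refl , refl)
  ... | inj₂ refl | inj₂ refl = contradiction refl (proj₁ F′~G′)

  -- The vertex-defining cycles form a vertex-faithful double cover.

  module _ {C : Pred (Cycle ℱ) 0ℓ} (C⇔VertexDefining : ∀ c → C c ⇔ VertexDefining c) where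
    ∃umbrella : (c : Cycle ℱ) → C c → VertexDefining c
    ∃umbrella c = Equivalence.to (C⇔VertexDefining c)

    vertexDefining-vertexFaithful : IsVertexFaithful ℱ C
    vertexDefining-vertexFaithful = record
      { chordless    = λ c c∈C → umbrella-chordless c (proj₂ (∃umbrella c c∈C))
      ; ≤1-commonArc = λ c d c∈C d∈C c≉d e f e∈c e∈d f∈c f∈d →
          commonArc c d (proj₂ (∃umbrella c c∈C)) (proj₂ (∃umbrella d d∈C)) c≉d e f e∈c e∈d f∈c f∈d
      }
      where
      commonArc : (c d : Cycle ℱ) {v w : Vertex} → IsUmbrella v (node c) → IsUmbrella w (node d) →
        ¬ (Setoid._≈_ (cycles ℱ) c d) → ∀ e f → _∈ᵃ_ ℱ e c → _∈ᵃ_ ℱ e d → _∈ᵃ_ ℱ f c → _∈ᵃ_ ℱ f d →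
        _≈ᵃ_ ℱ e f
      commonArc c d {v} {w} u u′ c≉d e f e∈c e∈d f∈c f∈d
        with ∈ᵃ⇒⊑ c u e e∈c | ∈ᵃ⇒⊑ d u′ e e∈d | ∈ᵃ⇒⊑ c u f f∈c | ∈ᵃ⇒⊑ d u′ f f∈d
      ... | a , b | a′ , b′ | p , q | p′ , q′ =
        same-arc v≢w a a′ b b′ p p′ q q′ (adjacent e) (adjacent f)
        where
        v≢w : v ≢ w
        v≢w refl = c≉d (umbrella-unique c d u u′)

    -- An arc lies exactly in the umbrellas of the two vertices `x` and `y` shared by its ends.
    vertexDefining-doubleCover : IsCycleDoubleCover ℱ C
    vertexDefining-doubleCover (arc {F} {G} F~G) with ∃missed F~G
    ... | m , m⊑F , m⋢G with other-vertices F m⊑F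
    ... | x , y , x≢y , x≢m , y≢m , x⊑F , y⊑F =
      inverse-from-section (which ∘ vertex)
        (λ {c} {d} c≈d → cong which (umbrella-vertex-unique (proj₁ c) (proj₁ d) (is-umbrella c) (is-umbrella d) c≈d))
        (λ {c} {d} eq → umbrella-unique (proj₁ c) (proj₁ d) (is-umbrella c)
          (subst (λ v → IsUmbrella v (node (proj₁ d))) (sym (which-injective (end c) (end d) eq)) (is-umbrella d)))
        section
      where
      Covering : Set
      Covering = Σ[ c ∈ Cycle ℱ ] C c × _∈ᵃ_ ℱ (arc F~G) c
      vertex : Covering → Vertex
      vertex (c , c∈C , _) = proj₁ (∃umbrella c c∈C)
      is-umbrella : ∀ c → IsUmbrella (vertex c) (node (proj₁ c))
      is-umbrella (c , c∈C , _) = proj₂ (∃umbrella c c∈C)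

      end : ∀ c → vertex c ≡ x ⊎ vertex c ≡ y
      end c@(_ , _ , e∈c) with ∈ᵃ⇒⊑ (proj₁ c) (is-umbrella c) (arc F~G) e∈c
      ... | v⊑F , v⊑G with one-of-three-vertices F x⊑F y⊑F m⊑F v⊑F x≢y x≢m y≢m
      ... | inj₁ v≡x        = inj₁ v≡x
      ... | inj₂ (inj₁ v≡y) = inj₂ v≡y
      ... | inj₂ (inj₂ v≡m) = contradiction (subst (_⊑ G) v≡m v⊑G) m⋢G

      -- Every vertex other than `x` gets the value of `y`; by `end` only `x` and `y` occur.
      which : Vertex → Fin 2
      which v with v ≟ˢ x
      ... | yes _ = zero
      ... | no _  = suc zero

      which-x : which x ≡ zero
      which-x with x ≟ˢ x
      ... | yes _  = refl
      ... | no x≢x = contradiction refl x≢x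

      which-y : which y ≡ suc zero
      which-y with y ≟ˢ x
      ... | yes y≡x = contradiction (sym y≡x) x≢y
      ... | no _    = refl

      which-injective : {v w : Vertex} → v ≡ x ⊎ v ≡ y → w ≡ x ⊎ w ≡ y → which v ≡ which w → v ≡ w
      which-injective (inj₁ refl) (inj₁ refl) eq = refl
      which-injective (inj₁ refl) (inj₂ refl) eq = contradiction (trans (sym which-x) (trans eq which-y)) λ ()
      which-injective (inj₂ refl) (inj₁ refl) eq = contradiction (trans (sym which-x) (trans (sym eq) which-y)) λ ()
      which-injective (inj₂ refl) (inj₂ refl) eq = refl

      covering : ∀ v → v ⊑ F → v ⊑ G → ∃[ c ] vertex c ≡ v
      -- Membership in `C` forgets the witness `v`; it is recovered because no cycle is the umbrella
      -- of two vertices.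
      covering v v⊑F v⊑G = c , umbrella-vertex-unique (proj₁ c) (proj₁ c) (is-umbrella c) (umbrellaCycle-umbrella v) (Setoid.refl (cycles ℱ))
        where
        c : Covering
        c = umbrellaCycle v ,
            Equivalence.from (C⇔VertexDefining _) (v , umbrellaCycle-umbrella v) ,
            ⊑⇒∈ᵃ (umbrellaCycle v) (umbrellaCycle-umbrella v) F~G v⊑F v⊑G

      section : ∀ k → ∃[ c ] which (vertex c) ≡ k
      section zero       = let c , eq = covering x x⊑F (others-shared F~G m⊑F m⋢G x⊑F x≢m)
                           in c , trans (cong which eq) which-x
      section (suc zero) = let c , eq = covering y y⊑F (others-shared F~G m⊑F m⋢G y⊑F y≢m)
                           in c , trans (cong which eq) which-y

  -- Automorphisms acting on vertices and faces.

  open PermutationGroup AutX using (_·_)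

  image-⊑ : ∀ φ {F : Face} {v : Vertex} → v ⊑ F ⇔ φ · v ⊑ to (onFaces φ) F
  image-⊑ φ {F} {v} = proj₂ (proj₂ φ F) v

  same-action : ∀ φ ψ → (∀ v → φ · v ≡ ψ · v) → ∀ F → to (onFaces φ) F ≡ to (onFaces ψ) F
  same-action φ ψ eq F = image-unique (proj₁ φ) {F} (proj₂ (proj₂ φ F))
    (IsImage-resp {proj₁ ψ} {proj₁ φ} {F} {to (onFaces ψ) F} (sym ∘ eq) (proj₂ (proj₂ ψ F)))

  -- This is the injectivity of `λX`: the image of `v` lies in every face through `v`.
  onFaces-trivial : ∀ φ → (∀ F → to (onFaces φ) F ≡ F) → ∀ v → φ · v ≡ v
  onFaces-trivial φ fix v = sym (faces-determine-vertex λ F v⊑F →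
    subst (φ · v ⊑_) (fix F) (Equivalence.to (image-⊑ φ) v⊑F))

  induced : Element AutX → Element λX[AutX]
  induced φ = onFaces φ , φ , λ _ → refl

  λX[AutX]≤Aut : λX[AutX] ≤ᴳ Aut ℱ
  λX[AutX]≤Aut π (φ , p) F G =
    subst₂ (λ K L → (F adjacentTo G) ⇔ (K adjacentTo L)) (p F) (p G) (onFaces-adjacent φ F G)

  -- Each neighbour misses one corner of `F`, so at least one of the three corners is missed by
  -- neither.
  neighbours-share-vertex : {F G₁ G₂ : Face} → F adjacentTo G₁ → F adjacentTo G₂ →
                            Σ[ w ∈ Vertex ] w ⊑ F × w ⊑ G₁ × w ⊑ G₂
  neighbours-share-vertex {F} F~G₁ F~G₂ with ∃missed F~G₁ | ∃missed F~G₂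
  ... | a , a⊑F , a⋢G₁ | b , b⊑F , b⋢G₂ with other-vertices F a⊑F
  ... | x , y , x≢y , x≢a , y≢a , x⊑F , y⊑F with x ≟ˢ b
  ... | no x≢b   = x , x⊑F , others-shared F~G₁ a⊑F a⋢G₁ x⊑F x≢a , others-shared F~G₂ b⊑F b⋢G₂ x⊑F x≢b
  ... | yes refl = y , y⊑F , others-shared F~G₁ a⊑F a⋢G₁ y⊑F y≢a ,
                   others-shared F~G₂ b⊑F b⋢G₂ y⊑F (x≢y ∘ sym)

-- From face-transitivity with three vertex orbits to the group.

module Vf⇒Group (X : SimplicialSurface)
                (faceTransitive : SimplicialSurface.FaceTransitive X)
                (vf : SimplicialSurface.HasVf X 3 1) where
  open SimplicialSurface X
  open Incidence X
  open HasVf vf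
  open PermutationGroup AutX using (_·_; identity; compose; inverse)

  colour : Vertex → Fin 3
  colour = to vertexOrbits

  colour-invariant : ∀ φ v → colour (φ · v) ≡ colour v
  colour-invariant φ v = sym (to-cong vertexOrbits (φ , refl))

  -- A representative of the orbit lies in some face, which face-transitivity carries to `F`.
  ∃coloured : ∀ F γ → Σ[ v ∈ Vertex ] v ⊑ F × colour v ≡ γ
  ∃coloured F γ with ∃face∋ (from vertexOrbits γ)
  ... | G , v⊑G with faceTransitive G F
  ... | φ , refl = φ · from vertexOrbits γ , Equivalence.to (image-⊑ φ) v⊑G ,
                   trans (colour-invariant φ _) (strictlyInverseˡ vertexOrbits γ)

  -- All three colours occur among the three corners, so none repeats.
  rainbow : ∀ F {v w : Vertex} → v ⊑ F → w ⊑ F → colour v ≡ colour w → v ≡ w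
  rainbow F v⊑F w⊑F eq with cornerIndex F v⊑F | cornerIndex F w⊑F
  ... | k , refl | l , refl = cong (corner F) (surjective⇒injective (colour ∘ corner F) surj eq)
    where
    surj : ∀ γ → ∃[ k ] colour (corner F k) ≡ γ
    surj γ with ∃coloured F γ
    ... | v , v⊑F , refl = let k , eq = cornerIndex F v⊑F in k , cong colour eq

  -- The colour is read at the source; `arcColour-reverse` shows that the target gives the same one.
  arcColour : Arc ℱ → Fin 3
  arcColour e = colour (missed (adjacent e))

  arcColour≡ : {F G : Face} {v : Vertex} (F~G : F adjacentTo G) → v ⊑ F → ¬ v ⊑ G →
               arcColour (arc F~G) ≡ colour v
  arcColour≡ F~G v⊑F v⋢G with ∃missed F~G
  ... | m , m⊑F , m⋢G = cong colour (missed-unique F~G v⊑F v⋢G m⊑F m⋢G)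

  -- The two shared vertices use two colours, which leaves the same third colour on both sides.
  arcColour-reverse : {F G : Face} (F~G : F adjacentTo G) (G~F : G adjacentTo F) →
                      arcColour (arc F~G) ≡ arcColour (arc G~F)
  arcColour-reverse {F} {G} F~G G~F with common-vertices F~G | ∃missed F~G | ∃missed G~F
  ... | x , y , x≢y , x⊑F , y⊑F , x⊑G , y⊑G | a , a⊑F , a⋢G | b , b⊑G , b⋢F =
    third-unique (x≢y ∘ rainbow F x⊑F y⊑F)
      (λ eq → a⋢G (subst (_⊑ G) (sym (rainbow F a⊑F x⊑F eq)) x⊑G))
      (λ eq → a⋢G (subst (_⊑ G) (sym (rainbow F a⊑F y⊑F eq)) y⊑G))
      (λ eq → b⋢F (subst (_⊑ F) (sym (rainbow G b⊑G x⊑G eq)) x⊑F))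
      (λ eq → b⋢F (subst (_⊑ F) (sym (rainbow G b⊑G y⊑G eq)) y⊑F))

  arcColour-image : ∀ φ {F G F′ G′ : Face} (F~G : F adjacentTo G) (F′~G′ : F′ adjacentTo G′) →
    to (onFaces φ) F ≡ F′ → to (onFaces φ) G ≡ G′ → arcColour (arc F~G) ≡ arcColour (arc F′~G′)
  arcColour-image φ F~G F′~G′ refl refl with ∃missed F~G
  ... | m , m⊑F , m⋢G = sym (trans
    (arcColour≡ F′~G′ (Equivalence.to (image-⊑ φ) m⊑F) (m⋢G ∘ Equivalence.from (image-⊑ φ)))
    (colour-invariant φ m))

  arcColour-cong : ∀ {e f} → Setoid._≈_ (arcOrbits ℱ λX[AutX]) e f → arcColour e ≡ arcColour f
  arcColour-cong {e} {f} ((π , φ , p) , inj₁ (eq , eq′)) =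
    arcColour-image φ (adjacent e) (adjacent f) (trans (p _) eq) (trans (p _) eq′)
  arcColour-cong {e} {f} ((π , φ , p) , inj₂ (eq , eq′)) =
    trans (arcColour-image φ (adjacent e) (~-sym (adjacent f)) (trans (p _) eq) (trans (p _) eq′))
      (arcColour-reverse (~-sym (adjacent f)) (adjacent f))

  -- An automorphism carrying source to source preserves colours, so by `rainbow` it matches the
  -- missed vertices and then, by `mate-unique`, the targets.
  arcColour-injective : ∀ {e f} → arcColour e ≡ arcColour f → Setoid._≈_ (arcOrbits ℱ λX[AutX]) e f
  arcColour-injective {arc {F} {G} F~G} {arc {F′} {G′} F′~G′} eq
    with ∃missed F~G | ∃missed F′~G′ | faceTransitive F F′
  ... | m , m⊑F , m⋢G | m′ , m′⊑F′ , m′⋢G′ | φ , refl = induced φ , inj₁ (refl ,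
    mate-unique F′~G′ (Equivalence.to (onFaces-adjacent φ F G) F~G) m′⊑F′ m′⋢G′
      (subst (λ v → ¬ v ⊑ to (onFaces φ) G) φm≡m′ (m⋢G ∘ Equivalence.from (image-⊑ φ))))
    where
    φm≡m′ : φ · m ≡ m′
    φm≡m′ = rainbow F′ (Equivalence.to (image-⊑ φ) m⊑F) m′⊑F′ (trans (colour-invariant φ m) eq)

  threeArcOrbits : HasCardinality (arcOrbits ℱ λX[AutX]) 3
  threeArcOrbits = inverse-from-section arcColour arcColour-cong arcColour-injective section
    where
    section : ∀ γ → ∃[ e ] arcColour e ≡ γ
    section γ with ∃coloured someFace γ
    ... | v , v⊑F , eq with ∃mate v⊑F
    ... | G , F~G , v⋢G = arc F~G , trans (arcColour≡ F~G v⊑F v⋢G) eq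

  stabiliser-trivial : ∀ F φ → to (onFaces φ) F ≡ F → ∀ v → φ · v ≡ v
  stabiliser-trivial F φ fix = to-injective (stabiliserOrder F) {φ , fix} {(↔-id Vertex , identity) , refl} (Fin1-≡ _ _)
    where
    Fin1-≡ : (i j : Fin 1) → i ≡ j
    Fin1-≡ zero zero = refl

  transitive : Transitive λX[AutX]
  transitive F G = let φ , eq = faceTransitive F G in induced φ , eq

  -- The group acts regularly, so evaluation at one face is a bijection. If `φ` and `ψ` agree there,
  -- the inverse of `ψ` after `φ` stabilises that face and is therefore trivial.
  order : Inverse (elements λX[AutX]) (≡-setoid Face)
  order = inverse-from-section (λ (π , _) → to π someFace) (λ eq → eq someFace)
    (λ {h} {k} → free h k) (transitive someFace)
    where
    free : ∀ h k → to (proj₁ h) someFace ≡ to (proj₁ k) someFace → ∀ F → to (proj₁ h) F ≡ to (proj₁ k) F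
    free (π , φ , p) (ρ , ψ , q) eq F = trans (sym (p F)) (trans (same-action φ ψ φ≗ψ F) (q F))
      where
      χ : Element AutX
      χ = ↔-sym (proj₁ ψ) ↔-∘ proj₁ φ , compose {↔-sym (proj₁ ψ)} {proj₁ φ} (inverse {proj₁ ψ} (proj₂ ψ)) (proj₂ φ)
      χ-fixes : to (onFaces χ) someFace ≡ someFace
      χ-fixes = trans (cong (from (onFaces ψ)) (trans (p someFace) (trans eq (sym (q someFace)))))
                  (strictlyInverseʳ (onFaces ψ) someFace)
      φ≗ψ : ∀ v → φ · v ≡ ψ · v
      φ≗ψ v = trans (sym (strictlyInverseˡ (proj₁ ψ) (φ · v)))
                (cong (to (proj₁ ψ)) (stabiliser-trivial someFace χ χ-fixes v))

  biColoured⇒umbrella : ∀ c → BiColoured ℱ arcColour c → VertexDefining c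
  biColoured⇒umbrella c b with ∃-third (BiColoured.colour₁ b) (BiColoured.colour₂ b)
  ... | γ , γ≢₁ , γ≢₂ with ∃coloured (node c (first (3≤length c))) γ
  ... | v , v⊑ , refl = v , closed-cycle-umbrella c (next-induction _ advance v⊑)
    where
    advance : ∀ i → v ⊑ node c i → v ⊑ node c (next i)
    -- If the cycle left `v` here, `v` would be the missed vertex and its absent colour would occur.
    advance i v⊑i = decidable-stable (v ⊑? node c (next i)) λ v⋢ →
      [ γ≢₁ ∘ trans (sym (arcColour≡ (step c i) v⊑i v⋢))
      , γ≢₂ ∘ trans (sym (arcColour≡ (step c i) v⊑i v⋢)) ]′ (BiColoured.only b i)

  umbrella⇒biColoured : ∀ c → VertexDefining c → BiColoured ℱ arcColour c
  umbrella⇒biColoured c (v , u) = record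
    { distinct    = alternating i₀
    ; occurs₁     = i₀ , refl
    ; occurs₂     = next i₀ , refl
    ; only        = only
    ; alternating = alternating
    }
    where
    i₀ : Fin (length c)
    i₀ = first (3≤length c)

    avoids : ∀ i → arcColour (arcAt c i) ≢ colour v
    avoids i eq with ∃missed (step c i)
    ... | m , m⊑ , m⋢ = m⋢ (subst (_⊑ node c (next i)) (sym (rainbow (node c i) m⊑ (v⊑node u i) eq))
                             (v⊑node u (next i)))

    alternating : ∀ i → arcColour (arcAt c i) ≢ arcColour (arcAt c (next i))
    -- The first arc is reversed so that both start at `node c (next i)`; there equal colours mean
    -- equal missed vertices, hence equal neighbours.
    alternating i eq = differ (trans (sym (arcColour-reverse (step c i) (~-sym (step c i)))) eq)
      where
      differ : arcColour (arc (~-sym (step c i))) ≢ arcColour (arcAt c (next i))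
      differ eq with ∃missed (~-sym (step c i)) | ∃missed (step c (next i))
      ... | a , a⊑ , a⋢ | b , b⊑ , b⋢ with rainbow (node c (next i)) a⊑ b⊑ eq
      ... | refl = next∘next≢id (3≤length c) i
              (injective c (mate-unique (~-sym (step c i)) (step c (next i)) a⊑ a⋢ b⋢))

    only : ∀ i → arcColour (arcAt c i) ≡ arcColour (arcAt c i₀) ⊎
                 arcColour (arcAt c i) ≡ arcColour (arcAt c (next i₀))
    only i = [ inj₁ , [ inj₂ , (λ eq → contradiction eq (avoids i)) ]′ ]′
      (one-of-three (alternating i₀) (avoids i₀) (avoids (next i₀)) (arcColour (arcAt c i)))

  biColoured⇔vertexDefining : ∀ c → BiColoured ℱ arcColour c ⇔ VertexDefining c
  biColoured⇔vertexDefining c = mk⇔ (biColoured⇒umbrella c) (umbrella⇒biColoured c)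

  is⟨3,1⟩Group : Is⟨3,1⟩Group ℱ λX[AutX]
  is⟨3,1⟩Group = record
    { cubic          = cubic
    ; nodeTransitive = λ F G → let (π , m) , eq = transitive F G in (π , λX[AutX]≤Aut π m) , eq
    ; subgroup       = λX[AutX]≤Aut
    ; transitive     = transitive
    ; order          = order
    ; threeArcOrbits = threeArcOrbits
    -- `threeArcOrbits` has `arcColour` as its forward map, so the colouring `κ` of this record
    -- computes to `arcColour`.
    ; doubleCover    = vertexDefining-doubleCover biColoured⇔vertexDefining
    ; vertexFaithful = vertexDefining-vertexFaithful biColoured⇔vertexDefining
    }

-- From the group back to vertex orbits and face stabilisers.

module Group⇒Vf (X : SimplicialSurface)
                (h : Is⟨3,1⟩Group (SimplicialSurface.ℱ X) (SimplicialSurface.λX[AutX] X))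
                (biColoured⇔vertexDefining : ∀ c →
                   Is⟨3,1⟩Group.𝒞⟨3,1⟩ h c ⇔ SimplicialSurface.VertexDefining X c) where
  open SimplicialSurface X
  open Incidence X
  open Is⟨3,1⟩Group h using (transitive; order; threeArcOrbits; κ)
  open PermutationGroup AutX using (_·_; identity)
  open PermutationGroup λX[AutX] using () renaming (identity to identityᶠ)

  faceTransitive : FaceTransitive
  faceTransitive F G = let (π , φ , p) , eq = transitive F G in φ , trans (p F) eq

  -- By transitivity F = g · F₀ ↦ order g is an injection of Face, so by finiteness
  -- every element of the group is one of the chosen translations.
  free : ∀ (k : Element λX[AutX]) F → to (proj₁ k) F ≡ F → ∀ G → to (proj₁ k) G ≡ G
  free k F fix G = trans (is-translation k F fix G) (sym (is-translation (↔-id Face , identityᶠ) F refl G))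
    where
    translation : Face → Element λX[AutX]
    translation K = proj₁ (transitive F K)
    translation-injective : Injective _≡_ _≡_ (to order ∘ translation)
    translation-injective {K} {L} eq = trans (sym (proj₂ (transitive F K)))
      (trans (to-injective order {translation K} {translation L} eq F) (proj₂ (transitive F L)))
    is-translation : ∀ (g : Element λX[AutX]) K → to (proj₁ g) F ≡ K → ∀ G → to (proj₁ g) G ≡ to (proj₁ (translation K)) G
    is-translation g K gF≡K with finite-surjective (simplices-finite 2) (to order ∘ translation) translation-injective (to order g)
    ... | L , eq with to-injective order {g} {translation L} (sym eq)
    ... | g≈ with trans (sym gF≡K) (trans (g≈ F) (proj₂ (transitive F L)))
    ... | refl = g≈

  -- By `free` an automorphism fixing one face fixes all of them, and then by injectivity of `λX`
  -- every vertex.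
  stabiliserOrder : ∀ F → HasCardinality (faceStabiliser F) 1
  stabiliserOrder F = inverse-from-section (λ _ → zero) (λ _ → refl)
    (λ { {φ , p} {ψ , q} _ v → trans (trivial φ p v) (sym (trivial ψ q v)) })
    (λ { zero → ((↔-id Vertex , identity) , refl) , refl })
    where
    trivial : ∀ φ → to (onFaces φ) F ≡ F → ∀ v → φ · v ≡ v
    trivial φ fix = onFaces-trivial φ (free (induced φ) F fix)

  κ-cong : ∀ {e f} → _≈ᵃ_ ℱ e f → κ e ≡ κ f
  κ-cong e≈f = to-cong threeArcOrbits ((↔-id Face , identityᶠ) , e≈f)

  umbrellaColours : ∀ v → BiColoured ℱ κ (umbrellaCycle v)
  umbrellaColours v = Equivalence.from (biColoured⇔vertexDefining _) (v , umbrellaCycle-umbrella v)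

  -- The three faces share a vertex, in whose umbrella the two arcs are consecutive; alternation of
  -- colours separates them.
  neighbours-differ : {F G₁ G₂ : Face} (F~G₁ : F adjacentTo G₁) (F~G₂ : F adjacentTo G₂) →
                      G₁ ≢ G₂ → κ (arc F~G₁) ≢ κ (arc F~G₂)
  neighbours-differ {F} {G₁} {G₂} F~G₁ F~G₂ G₁≢G₂ eq with neighbours-share-vertex F~G₁ F~G₂
  ... | v , v⊑F , v⊑G₁ , v⊑G₂ = clash (indexOf (umbrellaCycle-umbrella v) v⊑F)
    where
    c : Cycle ℱ
    c = umbrellaCycle v

    neighbour : ∀ i {G : Face} → node c i adjacentTo G → v ⊑ G →
                G ≡ node c (next i) ⊎ (∃[ j ] next j ≡ i × G ≡ node c j)
    neighbour i = neighbours-in-cycle c (v⊑node (umbrellaCycle-umbrella v)) i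

    alternating : ∀ j {G G′ : Face} (i~G : node c (next j) adjacentTo G) (i~G′ : node c (next j) adjacentTo G′) →
                  G ≡ node c (next (next j)) → G′ ≡ node c j → κ (arc i~G) ≢ κ (arc i~G′)
    alternating j i~G i~G′ refl refl eq = BiColoured.alternating (umbrellaColours v) j
      (trans (κ-cong {arcAt c j} {arc i~G′} (inj₂ (refl , refl)))
        (trans (sym eq) (κ-cong {arc i~G} {arcAt c (next j)} (inj₁ (refl , refl)))))

    clash : ¬ (∃[ i ] node c i ≡ F)
    clash (i , refl) with neighbour i F~G₁ v⊑G₁ | neighbour i F~G₂ v⊑G₂
    ... | inj₁ eq₁              | inj₁ eq₂              = G₁≢G₂ (trans eq₁ (sym eq₂))
    ... | inj₁ eq₁              | inj₂ (j , refl , eq₂) = alternating j F~G₁ F~G₂ eq₁ eq₂ eq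
    ... | inj₂ (j , refl , eq₁) | inj₁ eq₂              = alternating j F~G₂ F~G₁ eq₂ eq₁ (sym eq)
    ... | inj₂ (j , j→i , eq₁)  | inj₂ (k , k→i , eq₂)  =
      G₁≢G₂ (trans eq₁ (trans (cong (node c) (next-injective (trans j→i (sym k→i)))) (sym eq₂)))

  module _ {v : Vertex} where
    open BiColoured (umbrellaColours v) using (colour₁; colour₂; distinct; only)

    colours-at : {F G : Face} (F~G : F adjacentTo G) → v ⊑ F → v ⊑ G →
                 κ (arc F~G) ≡ colour₁ ⊎ κ (arc F~G) ≡ colour₂
    colours-at F~G v⊑F v⊑G =
      let i , e≈ = ⊑⇒∈ᵃ (umbrellaCycle v) (umbrellaCycle-umbrella v) F~G v⊑F v⊑G in subst (λ γ → γ ≡ colour₁ ⊎ γ ≡ colour₂)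
        (sym (κ-cong {arc F~G} {arcAt (umbrellaCycle v) i} e≈)) (only i)

    -- The other two arcs at `F` belong to the umbrella of `v` and differ in colour, so they use up
    -- both of its colours.
    opposite-avoids : {F G : Face} (F~G : F adjacentTo G) → v ⊑ F → ¬ v ⊑ G →
                      κ (arc F~G) ≢ colour₁ × κ (arc F~G) ≢ colour₂
    opposite-avoids {F} {G} F~G v⊑F v⋢G =
      let G₁ , G₂ , G₁≢G₂ , F~G₁ , v⊑G₁ , F~G₂ , v⊑G₂ = two-mates-at v⊑F
      in avoid (colours-at F~G₁ v⊑F v⊑G₁) (colours-at F~G₂ v⊑F v⊑G₂) (neighbours-differ F~G₁ F~G₂ G₁≢G₂)
           (neighbours-differ F~G F~G₁ (G≢ v⊑G₁)) (neighbours-differ F~G F~G₂ (G≢ v⊑G₂))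
      where
      G≢ : {K : Face} → v ⊑ K → G ≢ K
      G≢ v⊑K G≡K = v⋢G (subst (v ⊑_) (sym G≡K) v⊑K)
      avoid : ∀ {γ γ₁ γ₂} → γ₁ ≡ colour₁ ⊎ γ₁ ≡ colour₂ → γ₂ ≡ colour₁ ⊎ γ₂ ≡ colour₂ →
              γ₁ ≢ γ₂ → γ ≢ γ₁ → γ ≢ γ₂ → γ ≢ colour₁ × γ ≢ colour₂
      avoid (inj₁ p) (inj₁ q) γ₁≢γ₂ _ _ = contradiction (trans p (sym q)) γ₁≢γ₂
      avoid (inj₁ p) (inj₂ q) _ ≢₁ ≢₂   = (λ eq → ≢₁ (trans eq (sym p))) , λ eq → ≢₂ (trans eq (sym q))
      avoid (inj₂ p) (inj₁ q) _ ≢₁ ≢₂   = (λ eq → ≢₂ (trans eq (sym q))) , λ eq → ≢₁ (trans eq (sym p))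
      avoid (inj₂ p) (inj₂ q) γ₁≢γ₂ _ _ = contradiction (trans p (sym q)) γ₁≢γ₂

    opposite-unique : {F G F′ G′ : Face} (F~G : F adjacentTo G) (F′~G′ : F′ adjacentTo G′) →
      v ⊑ F → ¬ v ⊑ G → v ⊑ F′ → ¬ v ⊑ G′ → κ (arc F~G) ≡ κ (arc F′~G′)
    opposite-unique F~G F′~G′ v⊑F v⋢G v⊑F′ v⋢G′ =
      let ≢₁ , ≢₂ = opposite-avoids F~G v⊑F v⋢G
          ≢₁′ , ≢₂′ = opposite-avoids F′~G′ v⊑F′ v⋢G′
      in third-unique distinct ≢₁ ≢₂ ≢₁′ ≢₂′

  -- The face and its mate are arbitrary choices; `opposite-colour` removes the dependence on them.
  colour : Vertex → Fin 3
  colour v = let _ , v⊑F = ∃face∋ v ; _ , F~G , _ = ∃mate v⊑F in κ (arc F~G)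

  opposite-colour : {F G : Face} {v : Vertex} (F~G : F adjacentTo G) → v ⊑ F → ¬ v ⊑ G →
                    κ (arc F~G) ≡ colour v
  opposite-colour {v = v} F~G v⊑F v⋢G = let _ , v⊑K = ∃face∋ v ; _ , K~L , v⋢L = ∃mate v⊑K in
    opposite-unique F~G K~L v⊑F v⋢G v⊑K v⋢L

  -- `φ` carries an arc opposite to `v` to one opposite to `φ · v`, within a single arc orbit.
  colour-invariant : ∀ φ v → colour v ≡ colour (φ · v)
  colour-invariant φ v with ∃face∋ v
  ... | F , v⊑F with ∃mate v⊑F
  ... | G , F~G , v⋢G = trans (to-cong threeArcOrbits {arc F~G} {arc φF~φG} (induced φ , inj₁ (refl , refl)))
    (opposite-colour φF~φG (Equivalence.to (image-⊑ φ) v⊑F) (v⋢G ∘ Equivalence.from (image-⊑ φ)))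
    where
    φF~φG : to (onFaces φ) F adjacentTo to (onFaces φ) G
    φF~φG = Equivalence.to (onFaces-adjacent φ F G) F~G

  -- Distinct corners have distinct mates, and arcs to distinct neighbours differ in colour.
  rainbow : ∀ F {v w : Vertex} → v ⊑ F → w ⊑ F → colour v ≡ colour w → v ≡ w
  rainbow F {v} {w} v⊑F w⊑F eq = decidable-stable (v ≟ˢ w) λ v≢w →
    let G₁ , F~G₁ , v⋢G₁ = ∃mate v⊑F
        G₂ , F~G₂ , w⋢G₂ = ∃mate w⊑F
    in neighbours-differ F~G₁ F~G₂
         (λ G₁≡G₂ → w⋢G₂ (subst (w ⊑_) G₁≡G₂ (others-shared F~G₁ v⊑F v⋢G₁ w⊑F (v≢w ∘ sym))))
         (trans (opposite-colour F~G₁ v⊑F v⋢G₁) (trans eq (sym (opposite-colour F~G₂ w⊑F w⋢G₂))))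

  -- To join equally coloured `v` and `w`, move a face at `v` onto a face at `w`; `rainbow`
  -- identifies the image of `v` with `w`. All colours occur because three corners with distinct
  -- colours exhaust `Fin 3`.
  vertexOrbits : HasCardinality (orbits AutX) 3
  vertexOrbits = inverse-from-section colour (λ { (φ , refl) → colour-invariant φ _ }) same-orbit section
    where
    same-orbit : ∀ {v w} → colour v ≡ colour w → Setoid._≈_ (orbits AutX) v w
    same-orbit {v} {w} eq =
      let F , v⊑F = ∃face∋ v
          G , w⊑G = ∃face∋ w
          φ , φF≡G = faceTransitive F G
      in φ , rainbow G (subst (φ · v ⊑_) φF≡G (Equivalence.to (image-⊑ φ) v⊑F)) w⊑G
               (trans (sym (colour-invariant φ v)) eq)
    section : ∀ γ → ∃[ v ] colour v ≡ γ
    section γ = let k , eq = Fin-surjective (colour ∘ corner someFace)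
                      (corner-injective someFace ∘ rainbow someFace (corner⊑ someFace _) (corner⊑ someFace _)) γ
                in corner someFace k , eq

theorem4p5 : (X : SimplicialSurface) → let open SimplicialSurface X in
    (FaceTransitive × HasVf 3 1) ⇔
    (Σ[ h ∈ Is⟨3,1⟩Group ℱ λX[AutX] ]
    (∀ (c : Cycle ℱ) → Is⟨3,1⟩Group.𝒞⟨3,1⟩ h c ⇔ VertexDefining c))
theorem4p5 X = mk⇔
  (λ (faceTransitive , vf) →
    Vf⇒Group.is⟨3,1⟩Group X faceTransitive vf ,
    Vf⇒Group.biColoured⇔vertexDefining X faceTransitive vf)
  (λ (h , cover) → Group⇒Vf.faceTransitive X h cover , record
    { vertexOrbits    = Group⇒Vf.vertexOrbits X h cover
    ; stabiliserOrder = Group⇒Vf.stabiliserOrder X h cover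
    })
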